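{- We have \[\sum_{k\ge0}|\mathcal U_{2k+1}(231,4132)|\,x^k=C(xC(x)),\] where $C(x)=\frac{1-\sqrt{1-4x}}{2x}$ is the generating function of the Catalan numbers.
   Context: The stack-sorting map $s$ on permutations (finite words of distinct positive integers): $s(\text{empty})=\text{empty}$, and if $\pi=LnR$ with $n$ the largest entry, $s(\pi)=s(L)s(R)n$. A permutation is uniquely sorted if it has exactly one preimage under $s$. A permutation avoids $\tau$ if no subsequence has the same relative order as $\tau$; $\mathcal U_n(\tau^{(1)},\tau^{(2)})$ is the set of uniquely sorted permutations of $[n]$ avoiding both patterns. -}

module Defs where

open import Data.Nat using (ℕ; zero; suc; _+_; _*_; _∸_; _⊔_; _≡ᵇ_; _<ᵇ_)
open import Data.Nat.DivMod using (_/_)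
open import Data.Nat.Combinatorics using (_C_)
open import Data.Bool using (Bool; true; false; _∧_; _∨_; if_then_else_)
open import Data.List using (List; []; _∷_; _++_; map; length; filter; concatMap; foldr; upTo)
open import Data.Nat.ListAction using (sum)
open import Data.Bool.ListAction using (any)
open import Data.Product using (_×_; _,_)
open import Relation.Nullary.Decidable using (Dec)
open import Data.Bool using (T)
open import Relation.Nullary.Decidable using (T?)

range : ℕ → List ℕ
range n = map suc (upTo n)

insertions : ℕ → List ℕ → List (List ℕ)
insertions x []       = (x ∷ []) ∷ []
insertions x (y ∷ ys) = (x ∷ y ∷ ys) ∷ map (y ∷_) (insertions x ys)

perms : List ℕ → List (List ℕ)
perms []       = [] ∷ []
perms (x ∷ xs) = concatMap (insertions x) (perms xs)

Perm : ℕ → List (List ℕ)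
Perm n = perms (range n)

eqList : List ℕ → List ℕ → Bool
eqList []       []       = true
eqList (x ∷ xs) (y ∷ ys) = (x ≡ᵇ y) ∧ eqList xs ys
eqList _        _        = false

-- West's stack-sorting map:  s(LnR) = s(L) s(R) n,  n the largest entry

maxL : List ℕ → ℕ
maxL = foldr _⊔_ 0

breakAt : ℕ → List ℕ → List ℕ × List ℕ
breakAt m [] = [] , []
breakAt m (x ∷ xs) with x ≡ᵇ m
... | true  = [] , xs
... | false with breakAt m xs
...   | l , r = x ∷ l , r

-- fuel-driven version; fuel = length of the list is always enough
stackSortF : ℕ → List ℕ → List ℕ
stackSortF zero    _        = []
stackSortF (suc f) []       = []
stackSortF (suc f) (x ∷ xs) with breakAt (maxL (x ∷ xs)) (x ∷ xs)
... | L , R = stackSortF f L ++ stackSortF f R ++ (maxL (x ∷ xs) ∷ [])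

s : List ℕ → List ℕ
s π = stackSortF (length π) π

-- number of preimages of π (a permutation of [n]) under s
-- (preimages of a permutation of [n] are permutations of [n])
preimageCount : ℕ → List ℕ → ℕ
preimageCount n π = length (filter (λ σ → T? (eqList (s σ) π)) (Perm n))

uniquelySorted : ℕ → List ℕ → Bool
uniquelySorted n π = preimageCount n π ≡ᵇ 1

subseqs : List ℕ → List (List ℕ)
subseqs []       = [] ∷ []
subseqs (x ∷ xs) = map (x ∷_) (subseqs xs) ++ subseqs xs

-- same relative order (for words of distinct entries)
sameOrder : List ℕ → List ℕ → Bool
sameOrder []       []       = true
sameOrder (x ∷ xs) (y ∷ ys) = cmpAll xs ys ∧ sameOrder xs ys
  where
  cmpAll : List ℕ → List ℕ → Bool
  cmpAll []        []        = true
  cmpAll (x' ∷ as) (y' ∷ bs) =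
    (if x <ᵇ x' then (y <ᵇ y') else (if y <ᵇ y' then false else true)) ∧ cmpAll as bs
  cmpAll _         _         = false
sameOrder _        _        = false

contains : List ℕ → List ℕ → Bool
contains π τ = any (λ σ → sameOrder σ τ) (subseqs π)

avoids : List ℕ → List ℕ → Bool
avoids π τ = if contains π τ then false else true

U : ℕ → List (List ℕ)
U n = filter (λ π → T? (uniquelySorted n π ∧ avoids π (2 ∷ 3 ∷ 1 ∷ [])
                                           ∧ avoids π (4 ∷ 1 ∷ 3 ∷ 2 ∷ [])))
             (Perm n)

Series : Set
Series = ℕ → ℕ

sumTo : ℕ → (ℕ → ℕ) → ℕ
sumTo n f = sum (map f (upTo (suc n)))

_⊛_ : Series → Series → Series
(f ⊛ g) n = sumTo n (λ i → f i * g (n ∸ i))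

one : Series
one zero    = 1
one (suc _) = 0

pow : Series → ℕ → Series
pow f zero    = one
pow f (suc m) = f ⊛ pow f m

-- composition f(g(x)) for g with zero constant term:
-- [x^n] f(g(x)) = Σ_{m=0}^{n} f_m [x^n] g(x)^m
compose : Series → Series → Series
compose f g n = sumTo n (λ m → f m * pow g m n)

-- Catalan numbers: coefficients of C(x) = (1 - √(1-4x))/(2x)
catalan : ℕ → ℕ
catalan n = ((2 * n) C n) / suc n

C : Series
C = catalan

xC : Series
xC zero    = 0
xC (suc n) = catalan n

{-# OPTIONS --safe #-}

-- A nonempty word avoiding 231 is L k R with L < R < k, so such words are binary
-- trees.  Cut a word into j consecutive blocks, each with a chosen preimage under s.
-- In a cut of L k R the block ending with k is s(X k Y) = s(X) s(Y) k, so the cut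
-- amounts to a cut of L (whose last two blocks are s(X) and s(Y)) and a cut of R.
-- This computes the least number of blocks, and shows that the cut into that number
-- of blocks is unique iff every left subtree is empty or needs at least two blocks.
-- Uniquely sorted means that one block suffices and is unique.
--
-- Avoiding 4132 forces every right subtree R of the left spine to avoid 132, i.e. to
-- be a chain, and the chains needing d blocks are ballot paths, with generating
-- function Cᵈ.  With W(d) counting the trees that need d + 1 blocks, removing the root
-- gives W(d) = Cᵈ + x Σ W(e+1) C^(d-e) over e ≤ d.  The solution is W(d) = Cᵈ Uᵈ⁺¹
-- with U = C(xC), by telescoping Uᵃ⁺¹ = Uᵃ + xC Uᵃ⁺²; and W(0) = U.
module Submission where

open import Defs
open import Data.Bool using (true; false; T; _∧_)
open import Data.Bool.Properties using (T-∧)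
open import Data.Empty using (⊥; ⊥-elim)
open import Data.List
  using (List; []; _∷_; _++_; [_]; length; map; concatMap; filter; replicate; upTo; cartesianProductWith)
open import Data.List.Properties
open import Data.List.Membership.Propositional using (_∈_; _∉_; find; lose)
open import Data.List.Membership.Propositional.Properties
open import Data.List.Membership.Propositional.Properties.WithK using (unique∧set⇒bag)
open import Data.List.Relation.Binary.BagAndSetEquality using (∼bag⇒↭)
open import Data.List.Relation.Binary.Permutation.Propositional
  using (_↭_; prep; swap; ↭-refl; ↭-sym; ↭-trans; ↭-reflexive)
open import Data.List.Relation.Binary.Permutation.Propositional.Properties as ↭
  using (∈-resp-↭; All-resp-↭; ↭-empty-inv; ↭-length; drop-mid; ∷↭∷ʳ)
open import Data.List.Relation.Binary.Sublist.Propositional using (_⊆_; []; _∷_; _∷ʳ_; from∈)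
import Data.List.Relation.Binary.Sublist.Propositional as Sublist using (lookup)
import Data.List.Relation.Binary.Sublist.Propositional.Properties as Sublist using (++⁺; ++⁺ˡ; ++⁺ʳ; ∷ˡ⁻)
open import Data.List.Relation.Unary.All as All using (All; []; _∷_)
open import Data.List.Relation.Unary.All.Properties as All using ()
open import Data.List.Relation.Unary.AllPairs using ([]; _∷_)
open import Data.List.Relation.Unary.Any using (here; there)
open import Data.List.Relation.Unary.Any.Properties using (any⁺; any⁻)
open import Data.List.Relation.Unary.Unique.Propositional using (Unique)
open import Data.List.Relation.Unary.Unique.Propositional.Properties as Unique using (Unique[x∷xs]⇒x∉xs)
open import Data.Nat
open import Data.Nat.Combinatorics using (nCk+nC[k+1]≡[n+1]C[k+1]; nCk≡nC[n∸k]; nC1≡n)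
  renaming (_C_ to infixl 6.5 _choose_)
open import Data.Nat.DivMod using (_/_; m*n/n≡m)
open import Data.Nat.ListAction using (sum)
open import Data.Nat.Properties
open import Data.Nat.Tactic.RingSolver using (solve-∀)
open import Data.Product using (_×_; _,_; proj₁; proj₂; ∃-syntax)
open import Data.Sum using (_⊎_; inj₁; inj₂)
open import Data.Unit using (tt)
open import Function using (_∘_; _⇔_; mk⇔; Equivalence)
open import Relation.Binary.PropositionalEquality hiding ([_])
open import Relation.Nullary using (contradiction; yes; no; ¬_; ¬?)
open import Relation.Nullary.Decidable using (T?)
open ≡-Reasoning

-- Power series

-- Several blocks cannot be avoided: a preimage X k Y of the word L k satisfies s(X) s(Y) = L, so
-- one block of the word asks for two blocks of L, and iterating asks for any number. Blocks may be
-- empty, so a word that needs fewer blocks than are demanded of it is padded with empty ones. This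
-- costs nothing for existence, whence the truncated `∸ 2` in `blocks`, but the place of the padding
-- is a choice unless the word itself is empty. If no nonempty left subtree is padded, each of them
-- saves two blocks, so size = blocks + 2m with m the number of nonempty left subtrees. One block
-- thus forces the odd size 2m + 1, and every count below is indexed by blocks and m, with x marking
-- m. Series are never subtracted or divided: C = 1 + xC² enters as the recursion C^(d+1) = C^d + x
-- C^(d+2) for all powers at once, and the quotient formula of `catalan` serves only to identify its
-- values with `ballot 1`. Putting xC for x in this recursion is the origin of the telescoped
-- identity.

sumTo-suc : ∀ n f → sumTo (suc n) f ≡ f 0 + sumTo n (f ∘ suc)
sumTo-suc n f = cong (λ l → f 0 + sum l)
  (trans (map-applyUpTo suc f (suc n)) (sym (map-upTo (f ∘ suc) (suc n))))

sumTo-cong : ∀ n {f g} → (∀ i → i ≤ n → f i ≡ g i) → sumTo n f ≡ sumTo n g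
sumTo-cong zero f≡g = cong (_+ 0) (f≡g 0 z≤n)
sumTo-cong (suc n) {f} {g} f≡g = begin
  sumTo (suc n) f          ≡⟨ sumTo-suc n f ⟩
  f 0 + sumTo n (f ∘ suc)  ≡⟨ cong₂ _+_ (f≡g 0 z≤n) (sumTo-cong n λ i i≤n → f≡g (suc i) (s≤s i≤n)) ⟩
  g 0 + sumTo n (g ∘ suc)  ≡⟨ sym (sumTo-suc n g) ⟩
  sumTo (suc n) g          ∎

sumTo-+ : ∀ n f g → sumTo n (λ i → f i + g i) ≡ sumTo n f + sumTo n g
sumTo-+ zero f g = lem (f 0) (g 0)
  where
  lem : ∀ a b → a + b + 0 ≡ a + 0 + (b + 0)
  lem = solve-∀
sumTo-+ (suc n) f g = begin
  sumTo (suc n) (λ i → f i + g i)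
    ≡⟨ sumTo-suc n (λ i → f i + g i) ⟩
  f 0 + g 0 + sumTo n (λ i → f (suc i) + g (suc i))
    ≡⟨ cong (f 0 + g 0 +_) (sumTo-+ n (f ∘ suc) (g ∘ suc)) ⟩
  f 0 + g 0 + (sumTo n (f ∘ suc) + sumTo n (g ∘ suc))
    ≡⟨ lem (f 0) (g 0) _ _ ⟩
  f 0 + sumTo n (f ∘ suc) + (g 0 + sumTo n (g ∘ suc))
    ≡⟨ sym (cong₂ _+_ (sumTo-suc n f) (sumTo-suc n g)) ⟩
  sumTo (suc n) f + sumTo (suc n) g ∎
  where
  lem : ∀ a b c d → a + b + (c + d) ≡ a + c + (b + d)
  lem = solve-∀

sumTo-zero : ∀ n f → (∀ i → f i ≡ 0) → sumTo n f ≡ 0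
sumTo-zero zero f f≡0 = cong (_+ 0) (f≡0 0)
sumTo-zero (suc n) f f≡0 = trans (sumTo-suc n f) (cong₂ _+_ (f≡0 0) (sumTo-zero n (f ∘ suc) (f≡0 ∘ suc)))

sumTo-last : ∀ n f → sumTo (suc n) f ≡ sumTo n f + f (suc n)
sumTo-last zero f = lem (f 0) (f 1)
  where
  lem : ∀ a b → a + (b + 0) ≡ a + 0 + b
  lem = solve-∀
sumTo-last (suc n) f = begin
  sumTo (suc (suc n)) f                          ≡⟨ sumTo-suc (suc n) f ⟩
  f 0 + sumTo (suc n) (f ∘ suc)                  ≡⟨ cong (f 0 +_) (sumTo-last n (f ∘ suc)) ⟩
  f 0 + (sumTo n (f ∘ suc) + f (suc (suc n)))    ≡⟨ sym (+-assoc (f 0) _ _) ⟩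
  f 0 + sumTo n (f ∘ suc) + f (suc (suc n))      ≡⟨ cong (_+ f (suc (suc n))) (sym (sumTo-suc n f)) ⟩
  sumTo (suc n) f + f (suc (suc n))              ∎

sumTo-truncate : ∀ {n N} f → n ≤ N → (∀ i → n < i → f i ≡ 0) → sumTo N f ≡ sumTo n f
sumTo-truncate {zero} {zero} f _ _ = refl
sumTo-truncate {zero} {suc N} f _ f≡0 = begin
  sumTo (suc N) f          ≡⟨ sumTo-suc N f ⟩
  f 0 + sumTo N (f ∘ suc)  ≡⟨ cong (f 0 +_) (sumTo-zero N (f ∘ suc) λ i → f≡0 (suc i) (s≤s z≤n)) ⟩
  f 0 + 0                  ∎
sumTo-truncate {suc n} {suc N} f (s≤s n≤N) f≡0 = begin
  sumTo (suc N) f          ≡⟨ sumTo-suc N f ⟩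
  f 0 + sumTo N (f ∘ suc)  ≡⟨ cong (f 0 +_) (sumTo-truncate (f ∘ suc) n≤N λ i n<i → f≡0 (suc i) (s≤s n<i)) ⟩
  f 0 + sumTo n (f ∘ suc)  ≡⟨ sym (sumTo-suc n f) ⟩
  sumTo (suc n) f          ∎

_⊕_ : Series → Series → Series
(f ⊕ g) n = f n + g n

shift : Series → Series
shift f zero    = 0
shift f (suc n) = f n

⊛-zero : ∀ f g → (f ⊛ g) 0 ≡ f 0 * g 0
⊛-zero f g = +-identityʳ _

⊛-suc : ∀ f g n → (f ⊛ g) (suc n) ≡ f 0 * g (suc n) + ((f ∘ suc) ⊛ g) n
⊛-suc f g n = sumTo-suc n (λ i → f i * g (suc n ∸ i))

⊛-local : ∀ {f f′ g g′} n → (∀ i → i ≤ n → f i ≡ f′ i) → (∀ i → i ≤ n → g i ≡ g′ i) →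
          (f ⊛ g) n ≡ (f′ ⊛ g′) n
⊛-local n f≡ g≡ = sumTo-cong n λ i i≤n → cong₂ _*_ (f≡ i i≤n) (g≡ (n ∸ i) (m∸n≤m n i))

⊛-congˡ : ∀ f {g g′} → g ≗ g′ → f ⊛ g ≗ f ⊛ g′
⊛-congˡ f g≗ n = ⊛-local {f} {f} n (λ _ _ → refl) (λ i _ → g≗ i)

⊛-congʳ : ∀ g {f f′} → f ≗ f′ → f ⊛ g ≗ f′ ⊛ g
⊛-congʳ g f≗ n = ⊛-local {g = g} {g} n (λ i _ → f≗ i) (λ _ _ → refl)

⊛-distribʳ : ∀ f g h → (f ⊕ g) ⊛ h ≗ (f ⊛ h) ⊕ (g ⊛ h)
⊛-distribʳ f g h n = trans
  (sumTo-cong n λ i _ → *-distribʳ-+ (h (n ∸ i)) (f i) (g i))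
  (sumTo-+ n (λ i → f i * h (n ∸ i)) (λ i → g i * h (n ∸ i)))

⊛-distribˡ : ∀ f g h → f ⊛ (g ⊕ h) ≗ (f ⊛ g) ⊕ (f ⊛ h)
⊛-distribˡ f g h n = trans
  (sumTo-cong n λ i _ → *-distribˡ-+ (f i) (g (n ∸ i)) (h (n ∸ i)))
  (sumTo-+ n (λ i → f i * g (n ∸ i)) (λ i → f i * h (n ∸ i)))

sumTo-*ˡ : ∀ n c f → sumTo n (λ i → c * f i) ≡ c * sumTo n f
sumTo-*ˡ zero c f = lem c (f 0)
  where
  lem : ∀ c a → c * a + 0 ≡ c * (a + 0)
  lem = solve-∀
sumTo-*ˡ (suc n) c f = begin
  sumTo (suc n) (λ i → c * f i)            ≡⟨ sumTo-suc n (λ i → c * f i) ⟩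
  c * f 0 + sumTo n (λ i → c * f (suc i))  ≡⟨ cong (c * f 0 +_) (sumTo-*ˡ n c (f ∘ suc)) ⟩
  c * f 0 + c * sumTo n (f ∘ suc)          ≡⟨ sym (*-distribˡ-+ c (f 0) _) ⟩
  c * (f 0 + sumTo n (f ∘ suc))            ≡⟨ cong (c *_) (sym (sumTo-suc n f)) ⟩
  c * sumTo (suc n) f                      ∎

⊛-scaleˡ : ∀ c f g → (λ i → c * f i) ⊛ g ≗ (λ n → c * (f ⊛ g) n)
⊛-scaleˡ c f g n = trans
  (sumTo-cong n λ i _ → *-assoc c (f i) (g (n ∸ i)))
  (sumTo-*ˡ n c (λ i → f i * g (n ∸ i)))

⊛-assoc : ∀ f g h → (f ⊛ g) ⊛ h ≗ f ⊛ (g ⊛ h)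
⊛-assoc f g h zero = begin
  ((f ⊛ g) ⊛ h) 0      ≡⟨ ⊛-zero (f ⊛ g) h ⟩
  (f ⊛ g) 0 * h 0      ≡⟨ cong (_* h 0) (⊛-zero f g) ⟩
  f 0 * g 0 * h 0      ≡⟨ *-assoc (f 0) (g 0) (h 0) ⟩
  f 0 * (g 0 * h 0)    ≡⟨ cong (f 0 *_) (sym (⊛-zero g h)) ⟩
  f 0 * (g ⊛ h) 0      ≡⟨ sym (⊛-zero f (g ⊛ h)) ⟩
  (f ⊛ (g ⊛ h)) 0      ∎
⊛-assoc f g h (suc n) = begin
  ((f ⊛ g) ⊛ h) (suc n)
    ≡⟨ ⊛-suc (f ⊛ g) h n ⟩
  (f ⊛ g) 0 * h (suc n) + (((f ⊛ g) ∘ suc) ⊛ h) n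
    ≡⟨ cong₂ _+_ (cong (_* h (suc n)) (⊛-zero f g)) (⊛-congʳ h (⊛-suc f g) n) ⟩
  f 0 * g 0 * h (suc n) + (((λ i → f 0 * g (suc i)) ⊕ ((f ∘ suc) ⊛ g)) ⊛ h) n
    ≡⟨ cong (f 0 * g 0 * h (suc n) +_) (⊛-distribʳ (λ i → f 0 * g (suc i)) ((f ∘ suc) ⊛ g) h n) ⟩
  f 0 * g 0 * h (suc n) + (((λ i → f 0 * g (suc i)) ⊛ h) n + (((f ∘ suc) ⊛ g) ⊛ h) n)
    ≡⟨ cong (f 0 * g 0 * h (suc n) +_) (cong₂ _+_ (⊛-scaleˡ (f 0) (g ∘ suc) h n) (⊛-assoc (f ∘ suc) g h n)) ⟩
  f 0 * g 0 * h (suc n) + (f 0 * ((g ∘ suc) ⊛ h) n + ((f ∘ suc) ⊛ (g ⊛ h)) n)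
    ≡⟨ lem (f 0) (g 0) (h (suc n)) _ _ ⟩
  f 0 * (g 0 * h (suc n) + ((g ∘ suc) ⊛ h) n) + ((f ∘ suc) ⊛ (g ⊛ h)) n
    ≡⟨ cong (λ x → f 0 * x + ((f ∘ suc) ⊛ (g ⊛ h)) n) (sym (⊛-suc g h n)) ⟩
  f 0 * (g ⊛ h) (suc n) + ((f ∘ suc) ⊛ (g ⊛ h)) n
    ≡⟨ sym (⊛-suc f (g ⊛ h) n) ⟩
  (f ⊛ (g ⊛ h)) (suc n) ∎
  where
  lem : ∀ a b c x y → a * b * c + (a * x + y) ≡ a * (b * c + x) + y
  lem = solve-∀

-- Peels off the last term, where `⊛-suc` peels off the first. Both leave a convolution of smaller
-- index in which one factor is replaced by its tail, so commutativity follows by induction on the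
-- index.
⊛-sucʳ : ∀ f g n → (f ⊛ g) (suc n) ≡ (f ⊛ (g ∘ suc)) n + f (suc n) * g 0
⊛-sucʳ f g n = begin
  (f ⊛ g) (suc n)
    ≡⟨ sumTo-last n (λ i → f i * g (suc n ∸ i)) ⟩
  sumTo n (λ i → f i * g (suc n ∸ i)) + f (suc n) * g (n ∸ n)
    ≡⟨ cong₂ _+_
         (sumTo-cong n λ i i≤n → cong (λ k → f i * g k) (+-∸-assoc 1 i≤n))
         (cong (λ k → f (suc n) * g k) (n∸n≡0 n)) ⟩
  (f ⊛ (g ∘ suc)) n + f (suc n) * g 0 ∎

⊛-comm : ∀ f g → f ⊛ g ≗ g ⊛ f
⊛-comm f g zero = cong (_+ 0) (*-comm (f 0) (g 0))
⊛-comm f g (suc n) = begin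
  (f ⊛ g) (suc n)                        ≡⟨ ⊛-suc f g n ⟩
  f 0 * g (suc n) + ((f ∘ suc) ⊛ g) n    ≡⟨ cong₂ _+_ (*-comm (f 0) _) (⊛-comm (f ∘ suc) g n) ⟩
  g (suc n) * f 0 + (g ⊛ (f ∘ suc)) n    ≡⟨ +-comm (g (suc n) * f 0) _ ⟩
  (g ⊛ (f ∘ suc)) n + g (suc n) * f 0    ≡⟨ sym (⊛-sucʳ g f n) ⟩
  (g ⊛ f) (suc n)                        ∎

⊛-identityˡ : ∀ f → one ⊛ f ≗ f
⊛-identityˡ f zero = lem (f 0)
  where
  lem : ∀ a → 1 * a + 0 ≡ a
  lem = solve-∀
⊛-identityˡ f (suc n) = begin
  (one ⊛ f) (suc n)                          ≡⟨ ⊛-suc one f n ⟩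
  1 * f (suc n) + ((one ∘ suc) ⊛ f) n        ≡⟨ cong (1 * f (suc n) +_) (sumTo-zero n (λ _ → 0) λ _ → refl) ⟩
  1 * f (suc n) + 0                          ≡⟨ trans (+-identityʳ _) (*-identityˡ _) ⟩
  f (suc n)                                  ∎

⊛-identityʳ : ∀ f → f ⊛ one ≗ f
⊛-identityʳ f n = trans (⊛-comm f one n) (⊛-identityˡ f n)

shift-⊛ : ∀ f g → shift f ⊛ g ≗ shift (f ⊛ g)
shift-⊛ f g zero    = refl
shift-⊛ f g (suc n) = ⊛-suc (shift f) g n

⊛-shift : ∀ f g → f ⊛ shift g ≗ shift (f ⊛ g)
⊛-shift f g zero    = trans (⊛-comm f (shift g) 0) (shift-⊛ g f 0)
⊛-shift f g (suc n) = trans (⊛-comm f (shift g) (suc n)) (trans (shift-⊛ g f (suc n)) (⊛-comm g f n))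

⊛-sumTo : ∀ f (F : ℕ → Series) N →
          f ⊛ (λ i → sumTo N (λ m → F m i)) ≗ (λ n → sumTo N (λ m → (f ⊛ F m) n))
⊛-sumTo f F zero n = trans
  (⊛-congˡ f (λ i → +-identityʳ (F 0 i)) n) (sym (+-identityʳ _))
⊛-sumTo f F (suc N) n = begin
  (f ⊛ (λ i → sumTo (suc N) (λ m → F m i))) n
    ≡⟨ ⊛-congˡ f (λ i → sumTo-suc N (λ m → F m i)) n ⟩
  (f ⊛ (F 0 ⊕ (λ i → sumTo N (λ m → F (suc m) i)))) n
    ≡⟨ ⊛-distribˡ f (F 0) (λ i → sumTo N (λ m → F (suc m) i)) n ⟩
  (f ⊛ F 0) n + (f ⊛ (λ i → sumTo N (λ m → F (suc m) i))) n
    ≡⟨ cong ((f ⊛ F 0) n +_) (⊛-sumTo f (F ∘ suc) N n) ⟩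
  (f ⊛ F 0) n + sumTo N (λ m → (f ⊛ F (suc m)) n)
    ≡⟨ sym (sumTo-suc N (λ m → (f ⊛ F m) n)) ⟩
  sumTo (suc N) (λ m → (f ⊛ F m) n) ∎

⊛-scaleʳ : ∀ c f g → f ⊛ (λ i → c * g i) ≗ (λ n → c * (f ⊛ g) n)
⊛-scaleʳ c f g n = begin
  (f ⊛ (λ i → c * g i)) n  ≡⟨ ⊛-comm f (λ i → c * g i) n ⟩
  ((λ i → c * g i) ⊛ f) n  ≡⟨ ⊛-scaleˡ c g f n ⟩
  c * (g ⊛ f) n            ≡⟨ cong (c *_) (⊛-comm g f n) ⟩
  c * (f ⊛ g) n            ∎

-- Ballot numbers

-- The number of paths with steps +1 and -1 that start at height d, reach 0 only at their end, and
-- have m up steps. The first step, down or up, gives the recursion.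
ballot : ℕ → Series
ballot zero    zero    = 1
ballot zero    (suc m) = 0
ballot (suc d) zero    = ballot d zero
ballot (suc d) (suc m) = ballot d (suc m) + ballot (suc (suc d)) m

ballot-suc : ∀ d → ballot (suc d) ≗ ballot d ⊕ shift (ballot (suc (suc d)))
ballot-suc d zero    = sym (+-identityʳ _)
ballot-suc d (suc m) = refl

ballot₀ : ∀ d → ballot d 0 ≡ 1
ballot₀ zero    = refl
ballot₀ (suc d) = ballot₀ d

ballot-0 : ballot 0 ≗ one
ballot-0 zero    = refl
ballot-0 (suc m) = refl

-- A path from height a + b splits where it first reaches height b. In algebra: both sides satisfy
-- the same recursion in a; the induction is lexicographic on the index m and then on a.
ballot-+ : ∀ a b → ballot (a + b) ≗ ballot a ⊛ ballot b
ballot-+ a b zero = begin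
  ballot (a + b) 0             ≡⟨ ballot₀ (a + b) ⟩
  1                            ≡⟨ sym (cong₂ _*_ (ballot₀ a) (ballot₀ b)) ⟩
  ballot a 0 * ballot b 0      ≡⟨ sym (⊛-zero (ballot a) (ballot b)) ⟩
  (ballot a ⊛ ballot b) 0      ∎
ballot-+ zero b (suc m) = begin
  ballot b (suc m)               ≡⟨ sym (⊛-identityˡ (ballot b) (suc m)) ⟩
  (one ⊛ ballot b) (suc m)       ≡⟨ ⊛-congʳ (ballot b) (λ i → sym (ballot-0 i)) (suc m) ⟩
  (ballot 0 ⊛ ballot b) (suc m)  ∎
ballot-+ (suc a) b (suc m) = begin
  ballot (a + b) (suc m) + ballot (2 + a + b) m
    ≡⟨ cong₂ _+_ (ballot-+ a b (suc m)) (ballot-+ (2 + a) b m) ⟩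
  (ballot a ⊛ ballot b) (suc m) + (ballot (2 + a) ⊛ ballot b) m
    ≡⟨ cong ((ballot a ⊛ ballot b) (suc m) +_) (sym (shift-⊛ (ballot (2 + a)) (ballot b) (suc m))) ⟩
  (ballot a ⊛ ballot b) (suc m) + (shift (ballot (2 + a)) ⊛ ballot b) (suc m)
    ≡⟨ sym (⊛-distribʳ (ballot a) (shift (ballot (2 + a))) (ballot b) (suc m)) ⟩
  ((ballot a ⊕ shift (ballot (2 + a))) ⊛ ballot b) (suc m)
    ≡⟨ ⊛-congʳ (ballot b) (λ i → sym (ballot-suc a i)) (suc m) ⟩
  (ballot (suc a) ⊛ ballot b) (suc m) ∎

pascal : ∀ n k → suc n choose suc k ≡ n choose k + n choose suc k
pascal n k = sym (nCk+nC[k+1]≡[n+1]C[k+1] n k)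

-- The subtraction-free form of (k+1) C(n,k+1) = (n-k) C(n,k). It turns the difference of binomials
-- in `ballot-closed` into the quotient in `catalan`.
choose-absorption : ∀ n k → suc k * (n choose suc k) + k * (n choose k) ≡ n * (n choose k)
choose-absorption n zero = begin
  1 * (n choose 1) + 0  ≡⟨ trans (+-identityʳ _) (*-identityˡ _) ⟩
  n choose 1            ≡⟨ nC1≡n n ⟩
  n                ≡⟨ sym (*-identityʳ n) ⟩
  n * 1            ∎
choose-absorption zero (suc k) = cong₂ _+_ (*-zeroʳ (2 + k)) (*-zeroʳ (suc k))
choose-absorption (suc n) (suc k) = begin
  (2 + k) * (suc n choose (2 + k)) + suc k * (suc n choose suc k)
    ≡⟨ cong₂ (λ x y → (2 + k) * x + suc k * y) (pascal n (suc k)) (pascal n k) ⟩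
  (2 + k) * (b + c) + suc k * (a + b)
    ≡⟨ regroup k a b c ⟩
  ((2 + k) * c + suc k * b) + (suc k * b + k * a) + a + b
    ≡⟨ cong₂ (λ x y → x + y + a + b) (choose-absorption n (suc k)) (choose-absorption n k) ⟩
  n * b + n * a + a + b
    ≡⟨ collect n a b ⟩
  suc n * (a + b)
    ≡⟨ cong (suc n *_) (sym (pascal n k)) ⟩
  suc n * (suc n choose suc k) ∎
  where
  a = n choose k
  b = n choose suc k
  c = n choose (2 + k)
  regroup : ∀ k a b c → (2 + k) * (b + c) + suc k * (a + b) ≡
                        ((2 + k) * c + suc k * b) + (suc k * b + k * a) + a + b
  regroup = solve-∀
  collect : ∀ n a b → n * b + n * a + a + b ≡ suc n * (a + b)
  collect = solve-∀

-- The reflection principle, with the subtracted binomial moved to the left.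
ballot-closed : ∀ d m → ballot (suc d) (suc m) + ((2 * m + 2 + d) choose m) ≡ (2 * m + 2 + d) choose suc m
ballot-closed zero zero = refl
ballot-closed zero (suc m) = begin
  ballot 2 (suc m) + (2 * suc m + 2 + 0) choose suc m
    ≡⟨ cong (λ n → ballot 2 (suc m) + n choose suc m) idx ⟩
  ballot 2 (suc m) + suc N choose suc m
    ≡⟨ cong (ballot 2 (suc m) +_) (pascal N m) ⟩
  ballot 2 (suc m) + (N choose m + N choose suc m)
    ≡⟨ sym (+-assoc (ballot 2 (suc m)) _ _) ⟩
  ballot 2 (suc m) + N choose m + N choose suc m
    ≡⟨ cong (λ x → x + N choose suc m) (ballot-closed 1 m) ⟩
  N choose suc m + N choose suc m
    ≡⟨ cong (N choose suc m +_) central ⟩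
  N choose suc m + N choose (2 + m)
    ≡⟨ sym (pascal N (suc m)) ⟩
  suc N choose (2 + m)
    ≡⟨ cong (_choose (2 + m)) (sym idx) ⟩
  (2 * suc m + 2 + 0) choose (2 + m) ∎
  where
  N = 2 * m + 2 + 1
  idx : 2 * suc m + 2 + 0 ≡ suc N
  idx = lem m
    where
    lem : ∀ m → 2 * suc m + 2 + 0 ≡ suc (2 * m + 2 + 1)
    lem = solve-∀
  N≡ : N ≡ suc m + (2 + m)
  N≡ = lem m
    where
    lem : ∀ m → 2 * m + 2 + 1 ≡ suc m + (2 + m)
    lem = solve-∀
  -- The closed form continued to height 0 has to yield `ballot 0 (2 + m) = 0`; its two binomials
  -- are the equal middle entries of the odd row `N`.
  central : N choose suc m ≡ N choose (2 + m)
  central = begin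
    N choose suc m          ≡⟨ nCk≡nC[n∸k] (subst (suc m ≤_) (sym N≡) (m≤m+n (suc m) (2 + m))) ⟩
    N choose (N ∸ suc m)    ≡⟨ cong (λ x → N choose (x ∸ suc m)) N≡ ⟩
    N choose (suc m + (2 + m) ∸ suc m)  ≡⟨ cong (N choose_) (m+n∸m≡n (suc m) (2 + m)) ⟩
    N choose (2 + m) ∎
ballot-closed (suc d) zero = begin
  ballot (suc d) 1 + ballot (3 + d) 0 + 1   ≡⟨ cong (λ x → ballot (suc d) 1 + x + 1) (ballot₀ (3 + d)) ⟩
  ballot (suc d) 1 + 1 + 1                  ≡⟨ cong (_+ 1) (ballot-closed d 0) ⟩
  (2 + d) choose 1 + 1                           ≡⟨ cong (_+ 1) (nC1≡n (2 + d)) ⟩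
  2 + d + 1                                 ≡⟨ +-comm (2 + d) 1 ⟩
  3 + d                                     ≡⟨ sym (nC1≡n (3 + d)) ⟩
  (3 + d) choose 1                               ∎
ballot-closed (suc d) (suc m) = begin
  x + y + (2 * suc m + 2 + suc d) choose suc m
    ≡⟨ cong (λ n → x + y + n choose suc m) (+-suc (2 * suc m + 2) d) ⟩
  x + y + suc N choose suc m
    ≡⟨ cong (x + y +_) (pascal N m) ⟩
  x + y + (N choose m + N choose suc m)
    ≡⟨ regroup x y _ _ ⟩
  (y + N choose m) + (x + N choose suc m)
    ≡⟨ cong₂ _+_ up (ballot-closed d (suc m)) ⟩
  N choose suc m + N choose (2 + m)
    ≡⟨ sym (pascal N (suc m)) ⟩
  suc N choose (2 + m)
    ≡⟨ cong (_choose (2 + m)) (sym (+-suc (2 * suc m + 2) d)) ⟩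
  (2 * suc m + 2 + suc d) choose (2 + m) ∎
  where
  N = 2 * suc m + 2 + d
  x = ballot (suc d) (2 + m)
  y = ballot (3 + d) (suc m)
  up : y + N choose m ≡ N choose suc m
  up = subst (λ n → y + n choose m ≡ n choose suc m) (lem m d) (ballot-closed (2 + d) m)
    where
    lem : ∀ m d → 2 * m + 2 + (2 + d) ≡ 2 * suc m + 2 + d
    lem = solve-∀
  regroup : ∀ x y a b → x + y + (a + b) ≡ (y + a) + (x + b)
  regroup = solve-∀

-- With n = m + 1, the closed form at height 1 is C(2n,n) - C(2n,n-1), and absorption gives n
-- C(2n,n) = (n+1) C(2n,n-1). Hence n + 1 times the ballot number is C(2n,n), and the division is
-- exact.
catalan≡ballot : catalan ≗ ballot 1
catalan≡ballot zero    = refl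
catalan≡ballot (suc m) = begin
  ((2 * suc m) choose suc m) / (2 + m)        ≡⟨ cong (λ n → (n choose suc m) / (2 + m)) idx ⟩
  (N choose suc m) / (2 + m)                  ≡⟨ cong (_/ (2 + m)) (sym (+-cancelʳ-≡ (suc m * (N choose suc m)) (ballot 1 (suc m) * (2 + m)) (N choose suc m) key)) ⟩
  ballot 1 (suc m) * (2 + m) / (2 + m)   ≡⟨ m*n/n≡m (ballot 1 (suc m)) (2 + m) ⟩
  ballot 1 (suc m)                       ∎
  where
  N = 2 * m + 2 + 0
  idx : 2 * suc m ≡ N
  idx = lem m
    where
    lem : ∀ m → 2 * suc m ≡ 2 * m + 2 + 0
    lem = solve-∀
  absorb : suc m * (N choose suc m) ≡ (2 + m) * (N choose m)
  absorb = +-cancelʳ-≡ (m * (N choose m)) _ _ (trans (choose-absorption N m) (lem m (N choose m)))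
    where
    lem : ∀ m c → (2 * m + 2 + 0) * c ≡ (2 + m) * c + m * c
    lem = solve-∀
  key : ballot 1 (suc m) * (2 + m) + suc m * (N choose suc m) ≡ N choose suc m + suc m * (N choose suc m)
  key = begin
    ballot 1 (suc m) * (2 + m) + suc m * (N choose suc m)    ≡⟨ cong (ballot 1 (suc m) * (2 + m) +_) absorb ⟩
    ballot 1 (suc m) * (2 + m) + (2 + m) * (N choose m)      ≡⟨ lem (ballot 1 (suc m)) (N choose m) (2 + m) ⟩
    (2 + m) * (ballot 1 (suc m) + N choose m)                ≡⟨ cong ((2 + m) *_) (ballot-closed 0 m) ⟩
    (2 + m) * (N choose suc m)                               ∎
    where
    lem : ∀ b c k → b * k + k * c ≡ k * (b + c)
    lem = solve-∀

-- Substitution of xC into powers of C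

-- The composition C(xC)ᵃ; compose C xC is the case a = 1, since ballot 1 = C.
ballotCompose : ℕ → Series
ballotCompose a n = sumTo n (λ m → ballot a m * pow xC m n)

xC≡shift : xC ≗ shift (ballot 1)
xC≡shift zero    = refl
xC≡shift (suc n) = catalan≡ballot n

pow-xC-suc : ∀ m n → pow xC (suc m) (suc n) ≡ (ballot 1 ⊛ pow xC m) n
pow-xC-suc m n = trans (⊛-congʳ (pow xC m) xC≡shift (suc n)) (shift-⊛ (ballot 1) (pow xC m) (suc n))

pow-xC-vanishes : ∀ m n → n < m → pow xC m n ≡ 0
pow-xC-vanishes (suc m) zero    _         = refl
pow-xC-vanishes (suc m) (suc n) (s≤s n<m) = begin
  pow xC (suc m) (suc n)         ≡⟨ pow-xC-suc m n ⟩
  (ballot 1 ⊛ pow xC m) n        ≡⟨ ⊛-local {ballot 1} {ballot 1} {pow xC m} {λ _ → 0} n (λ _ _ → refl)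
                                      (λ i i≤n → pow-xC-vanishes m i (≤-<-trans i≤n n<m)) ⟩
  (ballot 1 ⊛ (λ _ → 0)) n       ≡⟨ ⊛-comm (ballot 1) (λ _ → 0) n ⟩
  ((λ _ → 0) ⊛ ballot 1) n       ≡⟨ sumTo-zero n (λ _ → 0) (λ _ → refl) ⟩
  0                              ∎

-- Since (xC)^m begins with x^m, all coefficients up to N can be summed to the common bound N. This
-- allows the sum over m to be exchanged with a convolution.
ballotCompose-truncate : ∀ a {n N} → n ≤ N → sumTo N (λ m → ballot a m * pow xC m n) ≡ ballotCompose a n
ballotCompose-truncate a {n} n≤N = sumTo-truncate (λ m → ballot a m * pow xC m n) n≤N λ i n<i →
  trans (cong (ballot a i *_) (pow-xC-vanishes i n n<i)) (*-zeroʳ (ballot a i))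

-- The recursion C^(a+1) = C^a + x C^(a+2) with xC in place of x. The index shift in the last term
-- leaves one spare factor xC, which comes out of the sum as `shift` and `ballot 1`.
ballotCompose-suc : ∀ a → ballotCompose (suc a) ≗
                          ballotCompose a ⊕ shift (ballot 1 ⊛ ballotCompose (2 + a))
ballotCompose-suc a zero = sym (+-identityʳ _)
ballotCompose-suc a (suc n) = begin
  ballotCompose (suc a) (suc n)
    ≡⟨ sumTo-suc n (λ m → ballot (suc a) m * p m (suc n)) ⟩
  ballot a 0 * p 0 (suc n) + sumTo n (λ m → (ballot a (suc m) + ballot (2 + a) m) * p (suc m) (suc n))
    ≡⟨ cong (ballot a 0 * p 0 (suc n) +_) (trans
         (sumTo-cong n λ m _ → *-distribʳ-+ (p (suc m) (suc n)) (ballot a (suc m)) (ballot (2 + a) m))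
         (sumTo-+ n (λ m → ballot a (suc m) * p (suc m) (suc n)) (λ m → ballot (2 + a) m * p (suc m) (suc n)))) ⟩
  ballot a 0 * p 0 (suc n) + (sumTo n (λ m → ballot a (suc m) * p (suc m) (suc n)) + R)
    ≡⟨ sym (+-assoc (ballot a 0 * p 0 (suc n)) _ R) ⟩
  ballot a 0 * p 0 (suc n) + sumTo n (λ m → ballot a (suc m) * p (suc m) (suc n)) + R
    ≡⟨ cong₂ _+_ (sym (sumTo-suc n (λ m → ballot a m * p m (suc n)))) R≡ ⟩
  ballotCompose a (suc n) + (ballot 1 ⊛ ballotCompose (2 + a)) n ∎
  where
  p = pow xC
  R = sumTo n (λ m → ballot (2 + a) m * p (suc m) (suc n))
  R≡ : R ≡ (ballot 1 ⊛ ballotCompose (2 + a)) n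
  R≡ = begin
    R
      ≡⟨ sumTo-cong n (λ m _ → trans (cong (ballot (2 + a) m *_) (pow-xC-suc m n))
           (sym (⊛-scaleʳ (ballot (2 + a) m) (ballot 1) (p m) n))) ⟩
    sumTo n (λ m → (ballot 1 ⊛ (λ i → ballot (2 + a) m * p m i)) n)
      ≡⟨ sym (⊛-sumTo (ballot 1) (λ m i → ballot (2 + a) m * p m i) n n) ⟩
    (ballot 1 ⊛ (λ i → sumTo n (λ m → ballot (2 + a) m * p m i))) n
      ≡⟨ ⊛-local {ballot 1} {ballot 1} {λ i → sumTo n (λ m → ballot (2 + a) m * p m i)} {ballotCompose (2 + a)}
           n (λ _ _ → refl) (λ i i≤n → ballotCompose-truncate (2 + a) i≤n) ⟩
    (ballot 1 ⊛ ballotCompose (2 + a)) n ∎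

ballotCompose-0 : ballotCompose 0 ≗ one
ballotCompose-0 zero    = refl
ballotCompose-0 (suc n) = trans (sumTo-suc n (λ m → ballot 0 m * pow xC m (suc n)))
  (sumTo-zero n (λ _ → 0) (λ _ → refl))

ballotCompose-telescope : ∀ d → ballotCompose (suc d) ≗
  one ⊕ shift (ballot 1 ⊛ (λ n → sumTo d (λ e → ballotCompose (2 + e) n)))
ballotCompose-telescope zero n = begin
  ballotCompose 1 n
    ≡⟨ ballotCompose-suc 0 n ⟩
  ballotCompose 0 n + shift (ballot 1 ⊛ ballotCompose 2) n
    ≡⟨ cong₂ _+_ (ballotCompose-0 n) (shift-cong (⊛-congˡ (ballot 1) (λ i → sym (+-identityʳ _))) n) ⟩
  one n + shift (ballot 1 ⊛ (λ n → sumTo 0 (λ e → ballotCompose (2 + e) n))) n ∎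
  where
  shift-cong : ∀ {f g} → f ≗ g → shift f ≗ shift g
  shift-cong f≗g zero    = refl
  shift-cong f≗g (suc n) = f≗g n
ballotCompose-telescope (suc d) zero = trans (ballotCompose-suc (suc d) 0)
  (trans (+-identityʳ _) (ballotCompose-telescope d 0))
ballotCompose-telescope (suc d) (suc n) = begin
  ballotCompose (2 + d) (suc n)
    ≡⟨ ballotCompose-suc (suc d) (suc n) ⟩
  ballotCompose (suc d) (suc n) + (ballot 1 ⊛ ballotCompose (3 + d)) n
    ≡⟨ cong (_+ (ballot 1 ⊛ ballotCompose (3 + d)) n) (ballotCompose-telescope d (suc n)) ⟩
  (ballot 1 ⊛ S d) n + (ballot 1 ⊛ ballotCompose (3 + d)) n
    ≡⟨ sym (⊛-distribˡ (ballot 1) (S d) (ballotCompose (3 + d)) n) ⟩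
  (ballot 1 ⊛ (S d ⊕ ballotCompose (3 + d))) n
    ≡⟨ ⊛-congˡ (ballot 1) (λ i → sym (sumTo-last d (λ e → ballotCompose (2 + e) i))) n ⟩
  (ballot 1 ⊛ S (suc d)) n ∎
  where
  S : ℕ → Series
  S d n = sumTo d (λ e → ballotCompose (2 + e) n)

-- W(d), introduced in its solved form. That it obeys the recursion obtained by removing the root is
-- `spine-zero` and `spine-suc`.
spine : ℕ → Series
spine d = ballot d ⊛ ballotCompose (suc d)

spine-zero : ∀ d → spine d 0 ≡ ballot d 0
spine-zero d = begin
  spine d 0                              ≡⟨ ⊛-zero (ballot d) (ballotCompose (suc d)) ⟩
  ballot d 0 * ballotCompose (suc d) 0   ≡⟨ cong (ballot d 0 *_) (ballotCompose-telescope d 0) ⟩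
  ballot d 0 * 1                         ≡⟨ *-identityʳ _ ⟩
  ballot d 0                             ∎

-- The telescoped identity multiplied by C^d. Its summand C^(d+1) U^(e+2) regroups as C^(d-e) times
-- C^(e+1) U^(e+2), and the latter factor is W(e+1).
spine-suc : ∀ d m → spine d (suc m) ≡
                    ballot d (suc m) + sumTo d (λ e → (spine (suc e) ⊛ ballot (d ∸ e)) m)
spine-suc d m = begin
  (ballot d ⊛ ballotCompose (suc d)) (suc m)
    ≡⟨ ⊛-congˡ (ballot d) (ballotCompose-telescope d) (suc m) ⟩
  (ballot d ⊛ (one ⊕ shift (ballot 1 ⊛ S))) (suc m)
    ≡⟨ ⊛-distribˡ (ballot d) one (shift (ballot 1 ⊛ S)) (suc m) ⟩
  (ballot d ⊛ one) (suc m) + (ballot d ⊛ shift (ballot 1 ⊛ S)) (suc m)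
    ≡⟨ cong₂ _+_ (⊛-identityʳ (ballot d) (suc m)) (⊛-shift (ballot d) (ballot 1 ⊛ S) (suc m)) ⟩
  ballot d (suc m) + (ballot d ⊛ (ballot 1 ⊛ S)) m
    ≡⟨ cong (ballot d (suc m) +_) tail ⟩
  ballot d (suc m) + sumTo d (λ e → (spine (suc e) ⊛ ballot (d ∸ e)) m) ∎
  where
  S : Series
  S n = sumTo d (λ e → ballotCompose (2 + e) n)
  term : ∀ e → e ≤ d → (ballot (d + 1) ⊛ ballotCompose (2 + e)) m ≡ (spine (suc e) ⊛ ballot (d ∸ e)) m
  term e e≤d = begin
    (ballot (d + 1) ⊛ ballotCompose (2 + e)) m
      ≡⟨ cong (λ k → (ballot k ⊛ ballotCompose (2 + e)) m) d+1≡ ⟩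
    (ballot ((d ∸ e) + suc e) ⊛ ballotCompose (2 + e)) m
      ≡⟨ ⊛-congʳ (ballotCompose (2 + e)) (ballot-+ (d ∸ e) (suc e)) m ⟩
    ((ballot (d ∸ e) ⊛ ballot (suc e)) ⊛ ballotCompose (2 + e)) m
      ≡⟨ ⊛-assoc (ballot (d ∸ e)) (ballot (suc e)) (ballotCompose (2 + e)) m ⟩
    (ballot (d ∸ e) ⊛ spine (suc e)) m
      ≡⟨ ⊛-comm (ballot (d ∸ e)) (spine (suc e)) m ⟩
    (spine (suc e) ⊛ ballot (d ∸ e)) m ∎
    where
    d+1≡ : d + 1 ≡ (d ∸ e) + suc e
    d+1≡ = trans (+-comm d 1) (trans (cong suc (sym (m∸n+n≡m e≤d))) (sym (+-suc (d ∸ e) e)))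
  tail : (ballot d ⊛ (ballot 1 ⊛ S)) m ≡ sumTo d (λ e → (spine (suc e) ⊛ ballot (d ∸ e)) m)
  tail = begin
    (ballot d ⊛ (ballot 1 ⊛ S)) m
      ≡⟨ sym (⊛-assoc (ballot d) (ballot 1) S m) ⟩
    ((ballot d ⊛ ballot 1) ⊛ S) m
      ≡⟨ ⊛-congʳ S (λ i → sym (ballot-+ d 1 i)) m ⟩
    (ballot (d + 1) ⊛ S) m
      ≡⟨ ⊛-sumTo (ballot (d + 1)) (λ e → ballotCompose (2 + e)) d m ⟩
    sumTo d (λ e → (ballot (d + 1) ⊛ ballotCompose (2 + e)) m)
      ≡⟨ sumTo-cong d term ⟩
    sumTo d (λ e → (spine (suc e) ⊛ ballot (d ∸ e)) m) ∎

spine-compose : ∀ k → spine 0 k ≡ compose C xC k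
spine-compose k = begin
  (ballot 0 ⊛ ballotCompose 1) k   ≡⟨ ⊛-congʳ (ballotCompose 1) ballot-0 k ⟩
  (one ⊛ ballotCompose 1) k        ≡⟨ ⊛-identityˡ (ballotCompose 1) k ⟩
  ballotCompose 1 k                ≡⟨ sumTo-cong k (λ m _ → cong (_* pow xC m k) (sym (catalan≡ballot m))) ⟩
  compose C xC k                   ∎

-- Shapes of words

concatMap-unique : ∀ {A B : Set} (f : A → List B) {xs} → Unique xs → (∀ x → x ∈ xs → Unique (f x)) →
                   (∀ {x y b} → x ∈ xs → y ∈ xs → b ∈ f x → b ∈ f y → x ≡ y) →
                   Unique (concatMap f xs)
concatMap-unique f [] uf inj = []
concatMap-unique f {x ∷ xs} (x∉ ∷ uxs) uf inj =
  Unique.++⁺ (uf x (here refl))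
    (concatMap-unique f uxs (λ y → uf y ∘ there) (λ p q → inj (there p) (there q)))
    λ (b∈fx , b∈rest) → let y , y∈xs , b∈fy = find (∈-concatMap⁻ f b∈rest)
                        in All.lookup x∉ y∈xs (inj (here refl) (there y∈xs) b∈fx b∈fy)

length-concatMap : ∀ {A B : Set} (f : A → List B) xs → length (concatMap f xs) ≡ sum (map (length ∘ f) xs)
length-concatMap f [] = refl
length-concatMap f (x ∷ xs) = trans (length-++ (f x)) (cong (length (f x) +_) (length-concatMap f xs))

length-cartesianProductWith : ∀ {A B D : Set} (f : A → B → D) xs ys →
                              length (cartesianProductWith f xs ys) ≡ length xs * length ys
length-cartesianProductWith f []       ys = refl
length-cartesianProductWith f (x ∷ xs) ys = trans (length-++ (map (f x) ys))
  (cong₂ _+_ (length-map (f x) ys) (length-cartesianProductWith f xs ys))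

data Tree : Set where
  ε    : Tree
  node : Tree → Tree → Tree

node-injective : ∀ {l l′ r r′} → node l r ≡ node l′ r′ → l ≡ l′ × r ≡ r′
node-injective refl = refl , refl

size : Tree → ℕ
size ε          = 0
size (node l r) = suc (size l + size r)

-- The least number of blocks w = w₁ ⋯ wⱼ, each a value of s, into which the
-- 231-avoiding word w of shape t can be cut.
blocks : Tree → ℕ
blocks ε          = 0
blocks (node l r) = suc ((blocks l ∸ 2) + blocks r)

-- The trees whose words admit only one cut into `blocks t` values of s, counted
-- together with the preimages of the blocks.
data Rigid : Tree → Set where
  ε    : Rigid ε
  node : ∀ {l r} → l ≡ ε ⊎ 2 ≤ blocks l → Rigid l → Rigid r → Rigid (node l r)

-- The shapes of words avoiding 231 and 132.
data Thin : Tree → Set where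
  ε         : Thin ε
  rightward : ∀ {r} → Thin r → Thin (node ε r)
  leftward  : ∀ {l} → Thin l → Thin (node l ε)

-- The shapes of words avoiding 231 and 4132.
data Spine : Tree → Set where
  ε    : Spine ε
  node : ∀ {l r} → Spine l → Thin r → Spine (node l r)

-- Enumeration of the rigid trees of thin and spine shape

thinTrees : ℕ → ℕ → List Tree
thinTrees zero    zero    = ε ∷ []
thinTrees zero    (suc m) = []
thinTrees (suc d) zero    = map (node ε) (thinTrees d zero)
-- Moving to the right child lowers the number of blocks by one, moving to a nonempty left child
-- raises it by one: these are the down and up steps of a ballot path.
thinTrees (suc d) (suc m) = map (node ε) (thinTrees d (suc m)) ++
                            map (λ l → node l ε) (thinTrees (2 + d) m)

length-thinTrees : ∀ d m → length (thinTrees d m) ≡ ballot d m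
length-thinTrees zero    zero    = refl
length-thinTrees zero    (suc m) = refl
length-thinTrees (suc d) zero    = trans (length-map (node ε) (thinTrees d 0)) (length-thinTrees d 0)
length-thinTrees (suc d) (suc m) = trans (length-++ (map (node ε) (thinTrees d (suc m))))
  (cong₂ _+_ (trans (length-map _ (thinTrees d (suc m))) (length-thinTrees d (suc m)))
             (trans (length-map _ (thinTrees (2 + d) m)) (length-thinTrees (2 + d) m)))

-- Here `m` counts the nonempty left subtrees: by rigidity each of them has at least two blocks and
-- loses exactly two at its parent, so the size exceeds `blocks t` by `2 * m`.
record IsThin (d m : ℕ) (t : Tree) : Set where
  constructor isThin
  field
    thin   : Thin t
    rigid  : Rigid t
    blocks≡ : blocks t ≡ d
    size≡  : size t ≡ d + 2 * m

isThin-right : ∀ {d m r} → IsThin d m r → IsThin (suc d) m (node ε r)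
isThin-right (isThin thin rigid blocks≡ size≡) =
  isThin (rightward thin) (node (inj₁ refl) ε rigid) (cong suc blocks≡) (cong suc size≡)

isThin-left : ∀ {d m l} → IsThin (2 + d) m l → IsThin (suc d) (suc m) (node l ε)
isThin-left {d} {m} {l} (isThin thin rigid blocks≡ size≡) = isThin (leftward thin)
  (node (inj₂ (subst (2 ≤_) (sym blocks≡) (s≤s (s≤s z≤n)))) rigid ε)
  (cong suc (trans (+-identityʳ _) (cong (_∸ 2) blocks≡)))
  (cong suc (trans (+-identityʳ (size l)) (trans size≡ (lem d m))))
  where
  lem : ∀ d m → 2 + d + 2 * m ≡ d + 2 * suc m
  lem = solve-∀

thinTrees-sound : ∀ d m {t} → t ∈ thinTrees d m → IsThin d m t
thinTrees-sound zero zero (here refl) = isThin ε ε refl refl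
thinTrees-sound (suc d) zero t∈ with ∈-map⁻ (node ε) t∈
... | r , r∈ , refl = isThin-right (thinTrees-sound d 0 r∈)
thinTrees-sound (suc d) (suc m) t∈ with ∈-++⁻ (map (node ε) (thinTrees d (suc m))) t∈
... | inj₁ t∈₁ with ∈-map⁻ (node ε) t∈₁
...   | r , r∈ , refl = isThin-right (thinTrees-sound d (suc m) r∈)
thinTrees-sound (suc d) (suc m) t∈ | inj₂ t∈₂ with ∈-map⁻ (λ l → node l ε) t∈₂
...   | l , l∈ , refl = isThin-left (thinTrees-sound (2 + d) m l∈)

thinTrees-right : ∀ d m {r} → r ∈ thinTrees d m → node ε r ∈ thinTrees (suc d) m
thinTrees-right d zero    r∈ = ∈-map⁺ (node ε) r∈
thinTrees-right d (suc m) r∈ = ∈-++⁺ˡ (∈-map⁺ (node ε) r∈)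

thinTrees-complete : ∀ {t} → Thin t → Rigid t → ∃[ m ] t ∈ thinTrees (blocks t) m
thinTrees-complete ε _ = 0 , here refl
thinTrees-complete {node ε r} (rightward thin) (node _ _ rigid) =
  let m , r∈ = thinTrees-complete thin rigid in m , thinTrees-right (blocks r) m r∈
-- The single node is both `rightward` and `leftward`; the enumeration lists it only in the first
-- role, which keeps it free of duplicates.
thinTrees-complete (leftward thin) (node (inj₁ refl) _ _) = 0 , here refl
thinTrees-complete {node l ε} (leftward thin) (node (inj₂ 2≤) rigid _) =
  let m , l∈ = thinTrees-complete thin rigid
      e , eq = m≤n⇒∃[o]m+o≡n 2≤
  in suc m , subst (λ b → node l ε ∈ thinTrees (suc b) (suc m))
       (trans (cong (_∸ 2) eq) (sym (+-identityʳ _)))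
       (∈-++⁺ʳ (map (node ε) (thinTrees e (suc m)))
         (∈-map⁺ (λ l → node l ε) (subst (λ b → l ∈ thinTrees b m) (sym eq) l∈)))

map-node-unique : ∀ {rs} → Unique rs → Unique (map (node ε) rs)
map-node-unique = Unique.map⁺ (proj₂ ∘ node-injective)

thinTrees-unique : ∀ d m → Unique (thinTrees d m)
thinTrees-unique zero    zero    = All.[] ∷ []
thinTrees-unique zero    (suc m) = []
thinTrees-unique (suc d) zero    = map-node-unique (thinTrees-unique d 0)
thinTrees-unique (suc d) (suc m) = Unique.++⁺
  (map-node-unique (thinTrees-unique d (suc m)))
  (Unique.map⁺ (proj₁ ∘ node-injective) (thinTrees-unique (2 + d) m))
  disjoint
  where
  disjoint : ∀ {t} → t ∈ map (node ε) (thinTrees d (suc m)) × t ∈ map (λ l → node l ε) (thinTrees (2 + d) m) → ⊥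
  disjoint (t∈₁ , t∈₂) with ∈-map⁻ (node ε) t∈₁ | ∈-map⁻ (λ l → node l ε) t∈₂
  -- A common tree would have the empty left subtree, which cannot need `2 + d` blocks.
  ... | _ , _ , refl | _ , l∈ , refl with IsThin.blocks≡ (thinTrees-sound (2 + d) m l∈)
  ...   | ()

-- The recursion is on the fuel f; it is exhaustive as soon as m < f.
spineTrees : ℕ → ℕ → ℕ → List Tree
spineNodesAt : ℕ → ℕ → ℕ → ℕ → List Tree
spineNodes : ℕ → ℕ → ℕ → ℕ → ℕ → List Tree

spineTrees zero    d m       = []
spineTrees (suc f) d zero    = map (node ε) (thinTrees d zero)
spineTrees (suc f) d (suc m) = map (node ε) (thinTrees d (suc m)) ++
  concatMap (spineNodesAt f d m) (upTo (suc d))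

spineNodesAt f d m e = concatMap (spineNodes f d m e) (upTo (suc m))

-- The left subtree needs e + 2 blocks. Two of them merge into the block of the root, the other e
-- remain, and the right subtree supplies `d ∸ e`.
spineNodes f d m e i = cartesianProductWith node (spineTrees f (suc e) i) (thinTrees (d ∸ e) (m ∸ i))

length-spineTrees : ∀ f d m → m < f → length (spineTrees f d m) ≡ spine d m
length-spineTrees (suc f) d zero    _         =
  trans (length-map (node ε) (thinTrees d 0)) (trans (length-thinTrees d 0) (sym (spine-zero d)))
length-spineTrees (suc f) d (suc m) (s≤s m<f) = begin
  length (map (node ε) (thinTrees d (suc m)) ++ rest)
    ≡⟨ length-++ (map (node ε) (thinTrees d (suc m))) ⟩
  length (map (node ε) (thinTrees d (suc m))) + length rest
    ≡⟨ cong₂ _+_ (trans (length-map (node ε) (thinTrees d (suc m))) (length-thinTrees d (suc m)))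
                 (length-concatMap (spineNodesAt f d m) (upTo (suc d))) ⟩
  ballot d (suc m) + sumTo d (length ∘ spineNodesAt f d m)
    ≡⟨ cong (ballot d (suc m) +_) (sumTo-cong d λ e _ →
         trans (length-concatMap (spineNodes f d m e) (upTo (suc m)))
               (sumTo-cong m λ i i≤m → len e i i≤m)) ⟩
  ballot d (suc m) + sumTo d (λ e → (spine (suc e) ⊛ ballot (d ∸ e)) m)
    ≡⟨ sym (spine-suc d m) ⟩
  spine d (suc m) ∎
  where
  rest = concatMap (spineNodesAt f d m) (upTo (suc d))
  len : ∀ e i → i ≤ m → length (spineNodes f d m e i) ≡ spine (suc e) i * ballot (d ∸ e) (m ∸ i)
  len e i i≤m = trans (length-cartesianProductWith node (spineTrees f (suc e) i) (thinTrees (d ∸ e) (m ∸ i)))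
    (cong₂ _*_ (length-spineTrees f (suc e) i (≤-<-trans i≤m m<f)) (length-thinTrees (d ∸ e) (m ∸ i)))

-- Indexed by one less than the number of blocks, which excludes the empty tree: the root always
-- accounts for one block.
record IsSpine (d m : ℕ) (t : Tree) : Set where
  constructor isSpine
  field
    spined : Spine t
    rigid  : Rigid t
    blocks≡ : blocks t ≡ suc d
    size≡  : size t ≡ suc d + 2 * m

isSpine-right : ∀ {d m r} → IsThin d m r → IsSpine d m (node ε r)
isSpine-right (isThin thin rigid blocks≡ size≡) =
  isSpine (node ε thin) (node (inj₁ refl) ε rigid) (cong suc blocks≡) (cong suc size≡)

isSpine-node : ∀ {d m e i l r} → e ≤ d → i ≤ m → IsSpine (suc e) i l → IsThin (d ∸ e) (m ∸ i) r →
               IsSpine d (suc m) (node l r)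
isSpine-node {d} {m} {e} {i} e≤d i≤m (isSpine sp rl bl sl) (isThin th rr br sr) = isSpine
  (node sp th)
  (node (inj₂ (subst (2 ≤_) (sym bl) (s≤s (s≤s z≤n)))) rl rr)
  (cong suc (trans (cong₂ (λ x y → x ∸ 2 + y) bl br) (m+[n∸m]≡n e≤d)))
  (cong suc (trans (cong₂ _+_ sl sr) (trans (lem e i (d ∸ e) (m ∸ i))
    (cong₂ (λ x y → x + 2 * suc y) (m+[n∸m]≡n e≤d) (m+[n∸m]≡n i≤m)))))
  where
  lem : ∀ e i d m → suc (suc e) + 2 * i + (d + 2 * m) ≡ (e + d) + 2 * suc (i + m)
  lem = solve-∀

record NodeMember (f d m : ℕ) (t : Tree) : Set where
  constructor member
  field
    {e i}  : ℕ
    {l r}  : Tree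
    e≤d    : e ≤ d
    i≤m    : i ≤ m
    l∈     : l ∈ spineTrees f (suc e) i
    r∈     : r ∈ thinTrees (d ∸ e) (m ∸ i)
    t≡     : t ≡ node l r

spineNodes⁻ : ∀ f d m {t} →
  t ∈ concatMap (spineNodesAt f d m) (upTo (suc d)) →
  NodeMember f d m t
spineNodes⁻ f d m t∈ with find (∈-concatMap⁻ (spineNodesAt f d m) t∈)
... | e , e∈ , t∈ₑ with find (∈-concatMap⁻ (spineNodes f d m e) {xs = upTo (suc m)} t∈ₑ)
...   | i , i∈ , t∈ᵢ with ∈-cartesianProductWith⁻ node (spineTrees f (suc e) i) (thinTrees (d ∸ e) (m ∸ i)) t∈ᵢ
...     | l , r , l∈ , r∈ , t≡ = member (s≤s⁻¹ (∈-upTo⁻ e∈)) (s≤s⁻¹ (∈-upTo⁻ i∈)) l∈ r∈ t≡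

spineTrees-sound : ∀ f d m {t} → t ∈ spineTrees f d m → IsSpine d m t
spineTrees-sound (suc f) d zero t∈ with ∈-map⁻ (node ε) t∈
... | r , r∈ , refl = isSpine-right (thinTrees-sound d 0 r∈)
spineTrees-sound (suc f) d (suc m) t∈ with ∈-++⁻ (map (node ε) (thinTrees d (suc m))) t∈
... | inj₁ t∈₁ with ∈-map⁻ (node ε) t∈₁
...   | r , r∈ , refl = isSpine-right (thinTrees-sound d (suc m) r∈)
spineTrees-sound (suc f) d (suc m) t∈ | inj₂ t∈₂ with spineNodes⁻ f d m t∈₂
... | member {e} {i} e≤d i≤m l∈ r∈ refl =
  isSpine-node e≤d i≤m (spineTrees-sound f (suc e) i l∈) (thinTrees-sound (d ∸ e) (m ∸ i) r∈)

spineTrees-right : ∀ f d m {r} → r ∈ thinTrees d m → node ε r ∈ spineTrees (suc f) d m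
spineTrees-right f d zero    r∈ = ∈-map⁺ (node ε) r∈
spineTrees-right f d (suc m) r∈ = ∈-++⁺ˡ (∈-map⁺ (node ε) r∈)

spineTrees-node : ∀ f d m e i {l r} → e ≤ d → i ≤ m → l ∈ spineTrees f (suc e) i →
                  r ∈ thinTrees (d ∸ e) (m ∸ i) → node l r ∈ spineTrees (suc f) d (suc m)
spineTrees-node f d m e i e≤d i≤m l∈ r∈ = ∈-++⁺ʳ (map (node ε) (thinTrees d (suc m)))
  (∈-concatMap⁺ (spineNodesAt f d m) (lose (∈-upTo⁺ (s≤s e≤d))
    (∈-concatMap⁺ (spineNodes f d m e) (lose (∈-upTo⁺ (s≤s i≤m))
      (∈-cartesianProductWith⁺ node l∈ r∈)))))

-- The fuel stays universally quantified because the index m is known only after the recursive call,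
-- and each caller then needs its own amount.
spineTrees-complete : ∀ {l r} → Spine (node l r) → Rigid (node l r) →
  ∃[ m ] (∀ f → m < f → node l r ∈ spineTrees f ((blocks l ∸ 2) + blocks r) m)
spineTrees-complete {r = r} (node _ thin) (node (inj₁ refl) _ rigid) =
  let m , r∈ = thinTrees-complete thin rigid
  in m , λ { (suc f) _ → spineTrees-right f (blocks r) m r∈ }
spineTrees-complete {node l₁ l₂} {r} (node sp thin) (node (inj₂ 2≤) rl rr) =
  let i , l∈ = spineTrees-complete sp rl
      j , r∈ = thinTrees-complete thin rr
      e , eq = m≤n⇒∃[o]m+o≡n 2≤
      b≡ = suc-injective (sym eq)
      e≡ = cong (_∸ 2) eq
  -- The extra one is the nonempty left subtree of the root itself.
  in suc (i + j) , λ { (suc f) (s≤s i+j<f) →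
    subst (λ k → node (node l₁ l₂) r ∈ spineTrees (suc f) (k + blocks r) (suc (i + j))) e≡
      (spineTrees-node f (e + blocks r) (i + j) e i (m≤m+n e _) (m≤m+n i j)
        (subst (λ b → node l₁ l₂ ∈ spineTrees f b i) b≡ (l∈ f (≤-<-trans (m≤m+n i j) i+j<f)))
        (subst₂ (λ x y → r ∈ thinTrees x y) (sym (m+n∸m≡n e (blocks r))) (sym (m+n∸m≡n i j)) r∈)) }

-- The indices of a listed tree can be read off its left subtree: e from the number of blocks, then
-- i from the size. So lists for different indices are disjoint.
spineTrees-unique : ∀ f d m → Unique (spineTrees f d m)
spineTrees-unique zero    d m       = []
spineTrees-unique (suc f) d zero    = map-node-unique (thinTrees-unique d 0)
spineTrees-unique (suc f) d (suc m) = Unique.++⁺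
  (map-node-unique (thinTrees-unique d (suc m)))
  (concatMap-unique (spineNodesAt f d m) (Unique.upTo⁺ (suc d))
    (λ e _ → concatMap-unique (spineNodes f d m e) (Unique.upTo⁺ (suc m))
      (λ i _ → Unique.cartesianProductWith⁺ node node-injective
        (spineTrees-unique f (suc e) i) (thinTrees-unique (d ∸ e) (m ∸ i)))
      λ {i} {j} _ _ t∈ᵢ t∈ⱼ → size-determines e i j t∈ᵢ t∈ⱼ)
    λ {e} {e′} _ _ t∈ t∈′ → blocks-determine e e′ t∈ t∈′)
  disjoint
  where
  left-sound : ∀ e i {t} → t ∈ spineNodes f d m e i → ∃[ l ] ∃[ r ] (t ≡ node l r × IsSpine (suc e) i l)
  left-sound e i t∈ with ∈-cartesianProductWith⁻ node (spineTrees f (suc e) i) (thinTrees (d ∸ e) (m ∸ i)) t∈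
  ... | l , r , l∈ , _ , t≡ = l , r , t≡ , spineTrees-sound f (suc e) i l∈
  size-determines : ∀ e i j {t} → t ∈ spineNodes f d m e i → t ∈ spineNodes f d m e j → i ≡ j
  size-determines e i j t∈ᵢ t∈ⱼ with left-sound e i t∈ᵢ | left-sound e j t∈ⱼ
  ... | _ , _ , refl , p | _ , _ , refl , q =
    *-cancelˡ-≡ i j 2 (+-cancelˡ-≡ (2 + e) (2 * i) (2 * j) (trans (sym (IsSpine.size≡ p)) (IsSpine.size≡ q)))
  blocks-determine : ∀ e e′ {t} → t ∈ spineNodesAt f d m e →
                     t ∈ spineNodesAt f d m e′ → e ≡ e′
  blocks-determine e e′ t∈ t∈′
    with find (∈-concatMap⁻ (spineNodes f d m e) {xs = upTo (suc m)} t∈) | find (∈-concatMap⁻ (spineNodes f d m e′) {xs = upTo (suc m)} t∈′)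
  ... | i , _ , t∈ᵢ | j , _ , t∈ⱼ with left-sound e i t∈ᵢ | left-sound e′ j t∈ⱼ
  ...   | _ , _ , refl , p | _ , _ , refl , q =
    suc-injective (suc-injective (trans (sym (IsSpine.blocks≡ p)) (IsSpine.blocks≡ q)))
  disjoint : ∀ {t} → t ∈ map (node ε) (thinTrees d (suc m)) ×
             t ∈ concatMap (spineNodesAt f d m) (upTo (suc d)) → ⊥
  disjoint (t∈₁ , t∈₂) with ∈-map⁻ (node ε) t∈₁ | spineNodes⁻ f d m t∈₂
  ... | _ , _ , refl | member {e} {i} _ _ l∈ _ refl with IsSpine.blocks≡ (spineTrees-sound f (suc e) i l∈)
  ...   | ()

-- The stack-sorting map

-- The offset `o` is the least value used. The left subtree receives the smallest values, the right
-- subtree the next ones, and the root the largest, although it is written between them.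
word : ℕ → Tree → List ℕ
word o ε          = []
word o (node l r) = word o l ++ (o + size l + size r) ∷ word (o + size l) r

word-≥ : ∀ o t → All (o ≤_) (word o t)
word-≥ o ε          = []
word-≥ o (node l r) = All.++⁺ (word-≥ o l)
  (≤-trans (m≤m+n o (size l)) (m≤m+n _ (size r)) ∷
   All.map (≤-trans (m≤m+n o (size l))) (word-≥ (o + size l) r))

word-< : ∀ o t → All (_< o + size t) (word o t)
word-< o ε          = []
word-< o (node l r) = subst (λ b → All (_< b) (word o (node l r))) eq (All.++⁺
  (All.map (λ x< → ≤-trans x< (≤-trans (m≤m+n (o + size l) (size r)) (n≤1+n _))) (word-< o l))
  (≤-refl ∷ All.map (λ x< → ≤-trans x< (n≤1+n _)) (word-< (o + size l) r)))
  where
  eq : suc (o + size l + size r) ≡ o + suc (size l + size r)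
  eq = trans (cong suc (+-assoc o (size l) (size r))) (sym (+-suc o _))

wordˡ-< : ∀ o l r → All (_< o + size l + size r) (word o l)
wordˡ-< o l r = All.map (λ x< → ≤-trans x< (m≤m+n (o + size l) (size r))) (word-< o l)

wordʳ-< : ∀ o l r → All (_< o + size l + size r) (word (o + size l) r)
wordʳ-< o l r = word-< (o + size l) r

∉-of-All< : ∀ {k xs} → All (_< k) xs → k ∉ xs
∉-of-All< xs<k k∈ = <-irrefl refl (All.lookup xs<k k∈)

first-occurrence : ∀ {k : ℕ} X X′ {Y Y′} → k ∉ X → k ∉ X′ → X ++ k ∷ Y ≡ X′ ++ k ∷ Y′ → X ≡ X′ × Y ≡ Y′
first-occurrence []      []       _   _    refl = refl , refl
first-occurrence []      (x ∷ X′) _   k∉X′ refl = contradiction (here refl) k∉X′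
first-occurrence (x ∷ X) []       k∉X _    refl = contradiction (here refl) k∉X
first-occurrence (x ∷ X) (x′ ∷ X′) k∉X k∉X′ eq with ∷-injective eq
... | refl , eq′ with first-occurrence X X′ (k∉X ∘ there) (k∉X′ ∘ there) eq′
...   | refl , Y≡Y′ = refl , Y≡Y′

last-occurrence : ∀ {k : ℕ} W A {B} → k ∉ B → W ++ [ k ] ≡ A ++ k ∷ B → B ≡ [] × W ≡ A
last-occurrence []      []      _   refl = refl , refl
last-occurrence (w ∷ W) []      k∉B refl = contradiction (∈-insert W) k∉B
last-occurrence []      (a ∷ []) _  ()
last-occurrence []      (a ∷ _ ∷ _) _ ()
last-occurrence (w ∷ W) (a ∷ A) k∉B eq with ∷-injective eq
... | refl , eq′ with last-occurrence W A k∉B eq′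
...   | B≡[] , refl = B≡[] , refl

++-split : ∀ {A : Set} (as : List A) {bs} L {k R} → as ++ bs ≡ L ++ k ∷ R →
           (∃[ D ] as ≡ L ++ k ∷ D × R ≡ D ++ bs) ⊎ (∃[ D ] L ≡ as ++ D × bs ≡ D ++ k ∷ R)
++-split []       L       eq   = inj₂ (L , refl , eq)
++-split (a ∷ as) []      refl = inj₁ (as , refl , refl)
++-split (a ∷ as) (x ∷ L) eq with ∷-injective eq
... | refl , eq′ with ++-split as L eq′
...   | inj₁ (D , refl , refl) = inj₁ (D , refl , refl)
...   | inj₂ (D , refl , refl) = inj₂ (D , refl , refl)

maxL-≥ : ∀ xs → All (_≤ maxL xs) xs
maxL-≥ []       = []
maxL-≥ (x ∷ xs) = m≤m⊔n x (maxL xs) ∷ All.map (λ y≤ → ≤-trans y≤ (m≤n⊔m x (maxL xs))) (maxL-≥ xs)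

maxL-∈ : ∀ x xs → maxL (x ∷ xs) ∈ x ∷ xs
maxL-∈ x []       = here (⊔-identityʳ x)
maxL-∈ x (y ∷ ys) with ⊔-sel x (maxL (y ∷ ys))
... | inj₁ eq = here eq
... | inj₂ eq = there (subst (_∈ y ∷ ys) (sym eq) (maxL-∈ y ys))

breakAt-++ : ∀ {m} L {R} → m ∉ L → breakAt m (L ++ m ∷ R) ≡ (L , R)
breakAt-++ {m} [] {R} m∉L with m ≡ᵇ m in eq
... | true  = refl
... | false = ⊥-elim (subst T eq (≡⇒≡ᵇ m m refl))
breakAt-++ {m} (x ∷ L) {R} m∉L with x ≡ᵇ m in eq
... | true  = contradiction (here (sym (≡ᵇ⇒≡ x m (subst T (sym eq) tt)))) m∉L
... | false rewrite breakAt-++ {m} L {R} (m∉L ∘ there) = refl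

split-at-first : ∀ {m π} → m ∈ π → ∃[ L ] ∃[ R ] π ≡ L ++ m ∷ R × m ∉ L
split-at-first {m} {x ∷ π} m∈ with x ≟ m
... | yes refl = [] , π , refl , λ ()
split-at-first {m} {x ∷ π} (here refl) | no x≢m = contradiction refl x≢m
split-at-first {m} {x ∷ π} (there m∈)  | no x≢m with split-at-first m∈
... | L , R , refl , m∉L = x ∷ L , R , refl , λ { (here eq) → x≢m (sym eq) ; (there m∈L) → m∉L m∈L }

record MaxSplit (π : List ℕ) : Set where
  constructor maxSplit
  field
    {L R}   : List ℕ
    π≡      : π ≡ L ++ maxL π ∷ R
    max∉L   : maxL π ∉ L

max-split : ∀ x xs → MaxSplit (x ∷ xs)
max-split x xs with split-at-first (maxL-∈ x xs)
... | L , R , π≡ , ∉L = maxSplit π≡ ∉L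

stackSortF-unfold : ∀ f x xs {L R} → breakAt (maxL (x ∷ xs)) (x ∷ xs) ≡ (L , R) →
  stackSortF (suc f) (x ∷ xs) ≡ stackSortF f L ++ stackSortF f R ++ [ maxL (x ∷ xs) ]
stackSortF-unfold f x xs eq with breakAt (maxL (x ∷ xs)) (x ∷ xs)
stackSortF-unfold f x xs refl | _ = refl

stackSortF-split : ∀ f {x xs} ((maxSplit {L} {R} _ _) : MaxSplit (x ∷ xs)) →
  stackSortF (suc f) (x ∷ xs) ≡ stackSortF f L ++ stackSortF f R ++ [ maxL (x ∷ xs) ]
stackSortF-split f {x} {xs} (maxSplit {L} {R} π≡ ∉L) =
  stackSortF-unfold f x xs (trans (cong (breakAt (maxL (x ∷ xs))) π≡) (breakAt-++ L ∉L))

split-lengths : ∀ {m x : ℕ} {xs} L {R} → x ∷ xs ≡ L ++ m ∷ R → length L ≤ length xs × length R ≤ length xs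
split-lengths {m} {x} {xs} L {R} eq =
  subst (length L ≤_) (sym len) (m≤m+n (length L) (length R)) ,
  subst (length R ≤_) (sym len) (m≤n+m (length R) (length L))
  where
  len : length xs ≡ length L + length R
  len = suc-injective (trans (cong length eq) (trans (length-++ L) (+-suc (length L) (length R))))

-- After one step of `s` the remaining fuel may exceed the lengths of both parts. Independence of
-- the fuel lets the recursive calls be read as `s` again, as in `s-split`.
stackSortF-fuel : ∀ f g π → length π ≤ f → length π ≤ g → stackSortF f π ≡ stackSortF g π
stackSortF-fuel zero    zero    []       _ _ = refl
stackSortF-fuel zero    (suc g) []       _ _ = refl
stackSortF-fuel (suc f) zero    []       _ _ = refl
stackSortF-fuel (suc f) (suc g) []       _ _ = refl
stackSortF-fuel (suc f) (suc g) (x ∷ xs) (s≤s ≤f) (s≤s ≤g) with max-split x xs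
... | ms@(maxSplit {L} {R} π≡ _) with split-lengths L π≡
...   | L≤ , R≤ = begin
  stackSortF (suc f) (x ∷ xs)
    ≡⟨ stackSortF-split f ms ⟩
  stackSortF f L ++ stackSortF f R ++ [ maxL (x ∷ xs) ]
    ≡⟨ cong₂ (λ a b → a ++ b ++ [ maxL (x ∷ xs) ])
         (stackSortF-fuel f g L (≤-trans L≤ ≤f) (≤-trans L≤ ≤g))
         (stackSortF-fuel f g R (≤-trans R≤ ≤f) (≤-trans R≤ ≤g)) ⟩
  stackSortF g L ++ stackSortF g R ++ [ maxL (x ∷ xs) ]
    ≡⟨ sym (stackSortF-split g ms) ⟩
  stackSortF (suc g) (x ∷ xs) ∎

s-split : ∀ {x xs} ((maxSplit {L} {R} _ _) : MaxSplit (x ∷ xs)) →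
          s (x ∷ xs) ≡ (s L ++ s R) ++ [ maxL (x ∷ xs) ]
s-split {x} {xs} ms@(maxSplit {L} {R} π≡ _) with split-lengths L π≡
... | L≤ , R≤ = begin
  s (x ∷ xs)
    ≡⟨ stackSortF-split (length xs) ms ⟩
  stackSortF (length xs) L ++ stackSortF (length xs) R ++ [ maxL (x ∷ xs) ]
    ≡⟨ cong₂ (λ a b → a ++ b ++ [ maxL (x ∷ xs) ])
         (stackSortF-fuel (length xs) (length L) L L≤ ≤-refl)
         (stackSortF-fuel (length xs) (length R) R R≤ ≤-refl) ⟩
  s L ++ s R ++ [ maxL (x ∷ xs) ]
    ≡⟨ sym (++-assoc (s L) (s R) _) ⟩
  (s L ++ s R) ++ [ maxL (x ∷ xs) ] ∎

stackSortF-↭ : ∀ f π → length π ≤ f → stackSortF f π ↭ π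
stackSortF-↭ zero    []       _ = ↭-refl
stackSortF-↭ (suc f) []       _ = ↭-refl
stackSortF-↭ (suc f) (x ∷ xs) (s≤s ≤f) with max-split x xs
... | ms@(maxSplit {L} {R} π≡ _) with split-lengths L π≡
...   | L≤ , R≤ = subst₂ _↭_ (sym (stackSortF-split f ms)) (sym π≡)
  (↭.++⁺ (stackSortF-↭ f L (≤-trans L≤ ≤f))
       (↭-trans (↭.++⁺ʳ [ maxL (x ∷ xs) ] (stackSortF-↭ f R (≤-trans R≤ ≤f)))
                (↭-sym (∷↭∷ʳ (maxL (x ∷ xs)) R))))

s-↭ : ∀ π → s π ↭ π
s-↭ π = stackSortF-↭ (length π) π ≤-refl

s-[]⁻ : ∀ {σ} → s σ ≡ [] → σ ≡ []
s-[]⁻ {σ} eq = ↭-empty-inv (↭-trans (↭-sym (s-↭ σ)) (subst (_↭ []) (sym eq) ↭-refl))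

s-All⁻ : ∀ {P : ℕ → Set} {σ} → All P (s σ) → All P σ
s-All⁻ {σ = σ} = All-resp-↭ (s-↭ σ)

maxL-unique : ∀ {k π} → k ∈ π → All (_≤ k) π → maxL π ≡ k
maxL-unique {k} {x ∷ xs} k∈ ≤k = ≤-antisym (All.lookup ≤k (maxL-∈ x xs)) (All.lookup (maxL-≥ (x ∷ xs)) k∈)

s-max : ∀ {k} X {Y} → All (_< k) X → All (_< k) Y → s (X ++ k ∷ Y) ≡ (s X ++ s Y) ++ [ k ]
s-max {k} X {Y} X<k Y<k = go (X ++ k ∷ Y) refl
  where
  go : ∀ π → π ≡ X ++ k ∷ Y → s π ≡ (s X ++ s Y) ++ [ k ]
  go [] eq = contradiction (subst (k ∈_) (sym eq) (∈-insert X)) λ ()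
  go (x ∷ xs) eq = trans (s-split (maxSplit {L = X} {Y} (trans eq (cong (λ m → X ++ m ∷ Y) (sym max≡)))
                                  (subst (_∉ X) (sym max≡) (∉-of-All< X<k))))
                         (cong (λ m → (s X ++ s Y) ++ [ m ]) max≡)
    where
    max≡ : maxL (x ∷ xs) ≡ k
    max≡ = trans (cong maxL eq) (maxL-unique (∈-insert X)
      (All.++⁺ (All.map <⇒≤ X<k) (≤-refl ∷ All.map <⇒≤ Y<k)))

record MaxPreimage (k : ℕ) (A : List ℕ) (σ : List ℕ) : Set where
  constructor maxPreimage
  field
    {X Y} : List ℕ
    σ≡    : σ ≡ X ++ k ∷ Y
    sXsY≡ : s X ++ s Y ≡ A

maxL-of-s : ∀ {k σ} A {B} → All (_< k) A → All (_< k) B → s σ ≡ A ++ k ∷ B → maxL σ ≡ k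
maxL-of-s {k} {σ} A A<k B<k eq = maxL-unique
  (∈-resp-↭ (s-↭ σ) (subst (k ∈_) (sym eq) (∈-insert A)))
  (s-All⁻ (subst (All (_≤ k)) (sym eq) (All.++⁺ (All.map <⇒≤ A<k) (≤-refl ∷ All.map <⇒≤ B<k))))

-- The map puts the largest entry last, so nothing follows k, and a preimage breaks at its first
-- occurrence of k.
s-max⁻ : ∀ {k σ} A {B} → All (_< k) A → All (_< k) B → s σ ≡ A ++ k ∷ B → B ≡ [] × MaxPreimage k A σ
s-max⁻ {σ = []}     []      _ _ ()
s-max⁻ {σ = []}     (_ ∷ _) _ _ ()
s-max⁻ {σ = x ∷ xs} A A<k B<k eq with maxL-of-s {σ = x ∷ xs} A A<k B<k eq | max-split x xs
... | refl | ms@(maxSplit {L} {R} π≡ _)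
  with last-occurrence (s L ++ s R) A (∉-of-All< B<k) (trans (sym (s-split ms)) eq)
...   | B≡[] , A≡ = B≡[] , maxPreimage π≡ A≡

-- Cutting a word into values of the map

-- Blocks are listed from right to left, so that the last two can be
-- reached by pattern matching.
cat : List (List ℕ) → List ℕ
cat []      = []
cat (σ ∷ ρ) = cat ρ ++ s σ

cat-++ : ∀ ρ τ → cat (ρ ++ τ) ≡ cat τ ++ cat ρ
cat-++ []      τ = sym (++-identityʳ (cat τ))
cat-++ (σ ∷ ρ) τ = trans (cong (_++ s σ) (cat-++ ρ τ)) (++-assoc (cat τ) (cat ρ) (s σ))

-- A block with empty value is empty, since `s` permutes entries. This settles a root without left
-- subtree, where X, Y and all earlier blocks are forced to be empty.
cat-[]-unique : ∀ ρ ρ′ → length ρ ≡ length ρ′ → cat ρ ≡ [] → cat ρ′ ≡ [] → ρ ≡ ρ′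
cat-[]-unique []      []        _   _  _   = refl
cat-[]-unique (σ ∷ ρ) (σ′ ∷ ρ′) len eq eq′ = cong₂ _∷_
  (trans (s-[]⁻ (++-conicalʳ (cat ρ) (s σ) eq)) (sym (s-[]⁻ (++-conicalʳ (cat ρ′) (s σ′) eq′))))
  (cat-[]-unique ρ ρ′ (suc-injective len) (++-conicalˡ (cat ρ) (s σ) eq) (++-conicalˡ (cat ρ′) (s σ′) eq′))

cat-pad : ∀ n ρ → cat (replicate n [] ++ ρ) ≡ cat ρ
cat-pad zero    ρ = refl
cat-pad (suc n) ρ = trans (++-identityʳ _) (cat-pad n ρ)

cat-All₂ : ∀ {P : ℕ → Set} Y X ρ {w} → cat (Y ∷ X ∷ ρ) ≡ w → All P w → All P X × All P Y
cat-All₂ Y X ρ refl all =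
  let left , sY = All.++⁻ (cat ρ ++ s X) all
      _ , sX    = All.++⁻ (cat ρ) left
  in s-All⁻ {σ = X} sX , s-All⁻ {σ = Y} sY

cat-max : ∀ {k L R} post Y X ρ → All (_< k) L → cat (Y ∷ X ∷ ρ) ≡ L → cat post ≡ R →
          cat (post ++ (X ++ k ∷ Y) ∷ ρ) ≡ L ++ k ∷ R
cat-max {k} {L} {R} post Y X ρ L<k eqL eqR = begin
  cat (post ++ (X ++ k ∷ Y) ∷ ρ)                   ≡⟨ cat-++ post _ ⟩
  (cat ρ ++ s (X ++ k ∷ Y)) ++ cat post            ≡⟨ cong₂ (λ a b → (cat ρ ++ a) ++ b) (s-max X X<k Y<k) eqR ⟩
  (cat ρ ++ (s X ++ s Y) ++ [ k ]) ++ R            ≡⟨ cong (_++ R) (sym (++-assoc (cat ρ) (s X ++ s Y) [ k ])) ⟩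
  ((cat ρ ++ s X ++ s Y) ++ [ k ]) ++ R            ≡⟨ cong (λ a → (a ++ [ k ]) ++ R) (trans (sym (++-assoc (cat ρ) (s X) (s Y))) eqL) ⟩
  (L ++ [ k ]) ++ R                                ≡⟨ ++-assoc L [ k ] R ⟩
  L ++ k ∷ R                                       ∎
  where
  X<k = proj₁ (cat-All₂ Y X ρ eqL L<k)
  Y<k = proj₂ (cat-All₂ Y X ρ eqL L<k)

-- Deleting k turns its block into the two blocks X and Y, either of which may be empty. Thus `ρ₀`
-- is two blocks shorter than the cut of L, which explains `∸ 2` in `blocks`, and `suc` stands for
-- the block of k.
record MaxCut (k : ℕ) (L R : List ℕ) (ρ : List (List ℕ)) : Set where
  constructor maxCut
  field
    {post ρ₀} : List (List ℕ)
    {X Y}     : List ℕ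
    ρ≡        : ρ ≡ post ++ (X ++ k ∷ Y) ∷ ρ₀
    catL      : cat (Y ∷ X ∷ ρ₀) ≡ L
    catR      : cat post ≡ R

cat-max⁻ : ∀ {k L R} ρ → All (_< k) L → All (_< k) R → cat ρ ≡ L ++ k ∷ R → MaxCut k L R ρ
cat-max⁻ {k} {L} [] L<k R<k eq = contradiction (subst (k ∈_) (sym eq) (∈-insert L)) λ ()
-- Either k lies in an earlier block, and σ joins the cut of R, or σ is the block of k, and then R
-- is empty by `s-max⁻`.
cat-max⁻ {k} {L} {R} (σ ∷ ρ) L<k R<k eq with ++-split (cat ρ) L eq
... | inj₁ (D , ρ≡ , refl) with cat-max⁻ ρ L<k (proj₁ (All.++⁻ D R<k)) ρ≡
...   | maxCut {post} refl catL catR = maxCut {post = σ ∷ post} refl catL (cong (_++ s σ) catR)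
cat-max⁻ {k} {L} {R} (σ ∷ ρ) L<k R<k eq | inj₂ (D , refl , sσ≡)
  with s-max⁻ {σ = σ} D (proj₂ (All.++⁻ (cat ρ) L<k)) R<k sσ≡
... | refl , maxPreimage {X} {Y} refl refl =
  maxCut {post = []} refl (++-assoc (cat ρ) (s X) (s Y)) refl

cut-node : ∀ o l r ρ → cat ρ ≡ word o (node l r) →
           MaxCut (o + size l + size r) (word o l) (word (o + size l) r) ρ
cut-node o l r ρ = cat-max⁻ ρ (wordˡ-< o l r) (wordʳ-< o l r)

length-maxCut : ∀ {A : Set} (post : List A) {x ρ₀} → length (post ++ x ∷ ρ₀) ≡ suc (length ρ₀ + length post)
length-maxCut post {x} {ρ₀} = trans (length-++ post) (+-comm (length post) (suc (length ρ₀)))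

blocks-≤ : ∀ o t ρ → cat ρ ≡ word o t → blocks t ≤ length ρ
blocks-≤ o ε          ρ eq = z≤n
blocks-≤ o (node l r) ρ eq with cut-node o l r ρ eq
... | maxCut {post} {ρ₀} {X} {Y} refl catL catR = subst (suc (blocks l ∸ 2 + blocks r) ≤_) (sym (length-maxCut post))
  (s≤s (+-mono-≤ (∸-monoˡ-≤ 2 (blocks-≤ o l (Y ∷ X ∷ ρ₀) catL)) (blocks-≤ (o + size l) r post catR)))

Cut : ℕ → List ℕ → Set
Cut j w = ∃[ ρ ] length ρ ≡ j × cat ρ ≡ w

pad-cut : ∀ {i j w} → i ≤ j → Cut i w → Cut j w
pad-cut {i} {j} i≤j (ρ , refl , eq) = replicate (j ∸ i) [] ++ ρ ,
  trans (length-++ (replicate (j ∸ i) [])) (trans (cong (_+ i) (length-replicate (j ∸ i))) (m∸n+n≡m i≤j)) ,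
  trans (cat-pad (j ∸ i) ρ) eq

blocks-cut : ∀ o t → Cut (blocks t) (word o t)
blocks-cut o ε          = [] , refl , refl
-- The cut of the left word is padded to at least two blocks, so that X and Y exist.
blocks-cut o (node l r) with pad-cut (m≤n+m∸n (blocks l) 2) (blocks-cut o l) | blocks-cut (o + size l) r
... | Y ∷ X ∷ ρ₀ , len , catL | post , lenR , catR =
  post ++ (X ++ _ ∷ Y) ∷ ρ₀ ,
  trans (length-maxCut post) (cong₂ (λ a b → suc (a + b)) (suc-injective (suc-injective len)) lenR) ,
  cat-max post Y X ρ₀ (wordˡ-< o l r) catL catR

UniqueCut : ℕ → List ℕ → Set
UniqueCut j w = ∀ ρ ρ′ → length ρ ≡ j → length ρ′ ≡ j → cat ρ ≡ w → cat ρ′ ≡ w → ρ ≡ ρ′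

-- Forces both halves of a minimal cut to be minimal, given that neither can be shorter than its own
-- minimum.
+-tight : ∀ {a b a′ b′} → a ≤ a′ → b ≤ b′ → a′ + b′ ≡ a + b → a′ ≡ a × b′ ≡ b
+-tight {a} {b} {a′} {b′} a≤ b≤ eq = a≡ , +-cancelˡ-≡ a′ b′ b (trans eq (cong (_+ b) (sym a≡)))
  where
  a≡ : a′ ≡ a
  a≡ = ≤-antisym (+-cancelʳ-≤ b a′ a (≤-trans (+-monoʳ-≤ a′ b≤) (≤-reflexive eq))) a≤

-- By `+-tight` the right part is a minimal cut. The left part consists of empty blocks if `l` is
-- empty; otherwise `2 ≤ blocks l` undoes the truncation, so it has exactly `blocks l` blocks and
-- induction applies.
rigid⇒unique : ∀ o {t} → Rigid t → UniqueCut (blocks t) (word o t)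
rigid⇒unique o ε [] [] _ _ _ _ = refl
rigid⇒unique o {node l r} (node l-ok rl rr) ρ ρ′ len len′ eq eq′
  with cut-node o l r ρ eq | cut-node o l r ρ′ eq′
... | maxCut {post} {ρ₀} {X} {Y} refl catL catR | maxCut {post′} {ρ₀′} {X′} {Y′} refl catL′ catR′
  = combine (left l-ok) (rigid⇒unique (o + size l) rr post post′ (proj₂ lens) (proj₂ lens′) catR catR′)
  where
  k = o + size l + size r
  lengths : ∀ post {ρ₀ X Y} → length (post ++ (X ++ k ∷ Y) ∷ ρ₀) ≡ blocks (node l r) →
            cat (Y ∷ X ∷ ρ₀) ≡ word o l → cat post ≡ word (o + size l) r →
            length ρ₀ ≡ blocks l ∸ 2 × length post ≡ blocks r
  lengths post {ρ₀} {X} {Y} len catL catR = +-tight (∸-monoˡ-≤ 2 (blocks-≤ o l (Y ∷ X ∷ ρ₀) catL)) (blocks-≤ (o + size l) r post catR)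
    (suc-injective (trans (sym (length-maxCut post)) len))
  lens  = lengths post len catL catR
  lens′ = lengths post′ len′ catL′ catR′
  left : l ≡ ε ⊎ 2 ≤ blocks l → Y ∷ X ∷ ρ₀ ≡ Y′ ∷ X′ ∷ ρ₀′
  left (inj₁ refl) = cat-[]-unique _ _ (cong (2 +_) (trans (proj₁ lens) (sym (proj₁ lens′)))) catL catL′
  left (inj₂ 2≤) = rigid⇒unique o rl _ _ (len≡ (proj₁ lens)) (len≡ (proj₁ lens′)) catL catL′
    where
    len≡ : ∀ {n} → n ≡ blocks l ∸ 2 → 2 + n ≡ blocks l
    len≡ n≡ = trans (cong (2 +_) n≡) (m+[n∸m]≡n 2≤)
  combine : Y ∷ X ∷ ρ₀ ≡ Y′ ∷ X′ ∷ ρ₀′ → post ≡ post′ →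
            post ++ (X ++ k ∷ Y) ∷ ρ₀ ≡ post′ ++ (X′ ++ k ∷ Y′) ∷ ρ₀′
  combine refl refl = refl

-- A one-block cut σ of word o l would extend to two different cuts σ | [] and [] | σ.
left-unique : ∀ o l → UniqueCut (2 + (blocks l ∸ 2)) (word o l) → l ≡ ε ⊎ 2 ≤ blocks l
left-unique o ε unq = inj₁ refl
left-unique o l@(node l₁ l₂) unq with 2 ≤? blocks l
... | yes 2≤ = inj₂ 2≤
... | no 2≰ with pad-cut (s≤s⁻¹ (≰⇒> 2≰)) (blocks-cut o l)
...   | σ ∷ [] , _ , eq with unq (σ ∷ [] ∷ []) ([] ∷ σ ∷ []) two two eq (trans (++-identityʳ (s σ)) eq)
  where
  two : 2 ≡ 2 + (blocks l ∸ 2)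
  two = cong (2 +_) (sym (m≤n⇒m∸n≡0 (<⇒≤ (≰⇒> 2≰))))
...     | refl = contradiction (subst (o + size l₁ + size l₂ ∈_) (sym eq) (∈-insert (word o l₁))) λ ()

-- With one side frozen at a chosen cut, gluing at k is injective in the other side, so uniqueness
-- is inherited by both. On the left this uses that k occurs in neither X, hence X k Y determines X
-- and Y.
unique⇒rigid : ∀ o t → UniqueCut (blocks t) (word o t) → Rigid t
unique⇒rigid o ε          _   = ε
unique⇒rigid o (node l r) unq
  with pad-cut (m≤n+m∸n (blocks l) 2) (blocks-cut o l) | blocks-cut (o + size l) r
... | Y ∷ X ∷ ρ₀ , len , catL | post , lenR , catR =
  node l-ok (left-rigid l-ok) (unique⇒rigid (o + size l) r right)
  where
  k = o + size l + size r
  glue : ∀ post x (ρ₀ : List (List ℕ)) → 2 + length ρ₀ ≡ 2 + (blocks l ∸ 2) → length post ≡ blocks r →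
         length (post ++ x ∷ ρ₀) ≡ blocks (node l r)
  glue post x ρ₀ len lenR =
    trans (length-maxCut post) (cong₂ (λ a b → suc (a + b)) (suc-injective (suc-injective len)) lenR)
  right : UniqueCut (blocks r) (word (o + size l) r)
  right ρ ρ′ len₁ len₂ eq eq′ = ++-cancelʳ ((X ++ k ∷ Y) ∷ ρ₀) ρ ρ′
    (unq _ _ (glue ρ (X ++ k ∷ Y) ρ₀ len len₁) (glue ρ′ (X ++ k ∷ Y) ρ₀ len len₂)
             (cat-max ρ Y X ρ₀ (wordˡ-< o l r) catL eq) (cat-max ρ′ Y X ρ₀ (wordˡ-< o l r) catL eq′))
  left : UniqueCut (2 + (blocks l ∸ 2)) (word o l)
  left (Y₁ ∷ X₁ ∷ ρ₁) (Y₂ ∷ X₂ ∷ ρ₂) len₁ len₂ eq₁ eq₂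
    with ∷-injective (++-cancelˡ post ((X₁ ++ k ∷ Y₁) ∷ ρ₁) ((X₂ ++ k ∷ Y₂) ∷ ρ₂)
           (unq _ _ (glue post (X₁ ++ k ∷ Y₁) ρ₁ len₁ lenR) (glue post (X₂ ++ k ∷ Y₂) ρ₂ len₂ lenR)
                    (cat-max post Y₁ X₁ ρ₁ (wordˡ-< o l r) eq₁ catR)
                    (cat-max post Y₂ X₂ ρ₂ (wordˡ-< o l r) eq₂ catR)))
  ... | XkY≡ , refl with first-occurrence X₁ X₂ (∉-of-All< (proj₁ (cat-All₂ Y₁ X₁ ρ₁ eq₁ (wordˡ-< o l r))))
                                                (∉-of-All< (proj₁ (cat-All₂ Y₂ X₂ ρ₂ eq₂ (wordˡ-< o l r)))) XkY≡
  ...   | refl , refl = refl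
  l-ok : l ≡ ε ⊎ 2 ≤ blocks l
  l-ok = left-unique o l left
  left-rigid : l ≡ ε ⊎ 2 ≤ blocks l → Rigid l
  left-rigid (inj₁ refl) = ε
  left-rigid (inj₂ 2≤)   = unique⇒rigid o l (subst (λ j → UniqueCut j (word o l)) (m+[n∸m]≡n 2≤) left)

-- Pattern avoidance

subseqs-sound : ∀ π {σ} → σ ∈ subseqs π → σ ⊆ π
subseqs-sound []      (here refl) = []
subseqs-sound (x ∷ π) σ∈ with ∈-++⁻ (map (x ∷_) (subseqs π)) σ∈
... | inj₂ σ∈₂ = x ∷ʳ subseqs-sound π σ∈₂
... | inj₁ σ∈₁ with ∈-map⁻ (x ∷_) σ∈₁
...   | _ , τ∈ , refl = refl ∷ subseqs-sound π τ∈

subseqs-complete : ∀ {π σ} → σ ⊆ π → σ ∈ subseqs π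
subseqs-complete []                 = here refl
subseqs-complete {x ∷ π} (.x ∷ʳ p)  = ∈-++⁺ʳ (map (x ∷_) (subseqs π)) (subseqs-complete p)
subseqs-complete {x ∷ π} (refl ∷ p) = ∈-++⁺ˡ (∈-map⁺ (x ∷_) (subseqs-complete p))

Occurs : List ℕ → List ℕ → Set
Occurs τ π = ∃[ σ ] σ ⊆ π × T (sameOrder σ τ)

contains⁺ : ∀ π τ → Occurs τ π → T (contains π τ)
contains⁺ π τ (σ , σ⊆π , ord) = any⁺ (λ σ → sameOrder σ τ) (lose (subseqs-complete σ⊆π) ord)

contains⁻ : ∀ π τ → T (contains π τ) → Occurs τ π
contains⁻ π τ c with find (any⁻ (λ σ → sameOrder σ τ) (subseqs π) c)
... | σ , σ∈ , ord = σ , subseqs-sound π σ∈ , ord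

avoids⁻ : ∀ π τ → T (avoids π τ) → ¬ Occurs τ π
avoids⁻ π τ av occ with contains π τ | contains⁺ π τ occ
... | true | _ = av

avoids⁺ : ∀ π τ → ¬ Occurs τ π → T (avoids π τ)
avoids⁺ π τ ¬occ with contains π τ | contains⁻ π τ
... | false | _ = tt
... | true  | c = ¬occ (c tt)

-- The weak inequality mirrors `sameOrder`, which only distinguishes `<` from its negation. As in
-- the next two records, the comparisons form a chain that implies the rest.
record Has231 (π : List ℕ) : Set where
  constructor has231
  field
    {a b c} : ℕ
    sub     : a ∷ b ∷ c ∷ [] ⊆ π
    a<b     : a < b
    c≤a     : c ≤ a

record Has132 (π : List ℕ) : Set where
  constructor has132
  field
    {a b c} : ℕ
    sub     : a ∷ b ∷ c ∷ [] ⊆ π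
    a<c     : a < c
    c≤b     : c ≤ b

record Has4132 (π : List ℕ) : Set where
  constructor has4132
  field
    {a b c d} : ℕ
    sub       : a ∷ b ∷ c ∷ d ∷ [] ⊆ π
    b<d       : b < d
    d≤c       : d ≤ c
    c≤a       : c ≤ a

<ᵇ-true : ∀ {m n} → (m <ᵇ n) ≡ true → m < n
<ᵇ-true {m} {n} eq = <ᵇ⇒< m n (subst T (sym eq) tt)

<ᵇ-false : ∀ {m n} → (m <ᵇ n) ≡ false → n ≤ m
<ᵇ-false {m} {n} eq = ≮⇒≥ λ m<n → subst T eq (<⇒<ᵇ m<n)

true-<ᵇ : ∀ {m n} → m < n → (m <ᵇ n) ≡ true
true-<ᵇ {m} {n} m<n with m <ᵇ n in eq
... | true  = refl
... | false = contradiction (<ᵇ-false eq) (<⇒≱ m<n)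

false-<ᵇ : ∀ {m n} → n ≤ m → (m <ᵇ n) ≡ false
false-<ᵇ {m} {n} n≤m with m <ᵇ n in eq
... | false = refl
... | true  = contradiction (<ᵇ-true eq) (≤⇒≯ n≤m)

occurs231⇒has231 : ∀ {π} → Occurs (2 ∷ 3 ∷ 1 ∷ []) π → Has231 π
occurs231⇒has231 (a ∷ b ∷ [] , sub , ord) with a <ᵇ b
occurs231⇒has231 (a ∷ b ∷ [] , sub , ()) | true
occurs231⇒has231 (a ∷ b ∷ [] , sub , ()) | false
occurs231⇒has231 (a ∷ b ∷ c ∷ [] , sub , ord) with a <ᵇ b in ab | a <ᵇ c in ac
... | true | false = has231 sub (<ᵇ-true ab) (<ᵇ-false ac)
occurs231⇒has231 (a ∷ b ∷ c ∷ _ ∷ _ , sub , ord) with a <ᵇ b | a <ᵇ c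
occurs231⇒has231 (a ∷ b ∷ c ∷ _ ∷ _ , sub , ()) | true  | false
occurs231⇒has231 (a ∷ b ∷ c ∷ _ ∷ _ , sub , ()) | true  | true

has231⇒occurs231 : ∀ {π} → Has231 π → Occurs (2 ∷ 3 ∷ 1 ∷ []) π
has231⇒occurs231 (has231 {a} {b} {c} sub a<b c≤a) = _ , sub , ord
  where
  ord : T (sameOrder (a ∷ b ∷ c ∷ []) (2 ∷ 3 ∷ 1 ∷ []))
  ord rewrite true-<ᵇ a<b | false-<ᵇ c≤a | false-<ᵇ (≤-trans c≤a (<⇒≤ a<b)) = tt

occurs4132⇒has4132 : ∀ {π} → Occurs (4 ∷ 1 ∷ 3 ∷ 2 ∷ []) π → Has4132 π
occurs4132⇒has4132 (a ∷ b ∷ [] , sub , ord) with a <ᵇ b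
occurs4132⇒has4132 (a ∷ b ∷ [] , sub , ()) | true
occurs4132⇒has4132 (a ∷ b ∷ [] , sub , ()) | false
occurs4132⇒has4132 (a ∷ b ∷ c ∷ [] , sub , ord) with a <ᵇ b | a <ᵇ c
occurs4132⇒has4132 (a ∷ b ∷ c ∷ [] , sub , ()) | false | false
occurs4132⇒has4132 (a ∷ b ∷ c ∷ [] , sub , ()) | false | true
occurs4132⇒has4132 (a ∷ b ∷ c ∷ d ∷ [] , sub , ord)
  with a <ᵇ b | a <ᵇ c in ac | a <ᵇ d | b <ᵇ c | b <ᵇ d in bd | c <ᵇ d in cd
... | false | false | false | true | true | false = has4132 sub (<ᵇ-true bd) (<ᵇ-false cd) (<ᵇ-false ac)
occurs4132⇒has4132 (a ∷ b ∷ c ∷ d ∷ _ ∷ _ , sub , ord) with a <ᵇ b | a <ᵇ c | a <ᵇ d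
occurs4132⇒has4132 (a ∷ b ∷ c ∷ d ∷ _ ∷ _ , sub , ()) | false | false | false
occurs4132⇒has4132 (a ∷ b ∷ c ∷ d ∷ _ ∷ _ , sub , ()) | false | false | true

has4132⇒occurs4132 : ∀ {π} → Has4132 π → Occurs (4 ∷ 1 ∷ 3 ∷ 2 ∷ []) π
has4132⇒occurs4132 (has4132 {a} {b} {c} {d} sub b<d d≤c c≤a) = _ , sub , ord
  where
  b<c : b < c
  b<c = ≤-trans b<d d≤c
  ord : T (sameOrder (a ∷ b ∷ c ∷ d ∷ []) (4 ∷ 1 ∷ 3 ∷ 2 ∷ []))
  ord rewrite false-<ᵇ (≤-trans (<⇒≤ b<c) c≤a) | false-<ᵇ c≤a | false-<ᵇ (≤-trans d≤c c≤a)
            | true-<ᵇ b<c | true-<ᵇ b<d | false-<ᵇ d≤c = tt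

⊆-++⁻ : ∀ {A : Set} (xs : List A) {ys σ} → σ ⊆ xs ++ ys → ∃[ σ₁ ] ∃[ σ₂ ] σ ≡ σ₁ ++ σ₂ × σ₁ ⊆ xs × σ₂ ⊆ ys
⊆-++⁻ []       p = [] , _ , refl , [] , p
⊆-++⁻ (x ∷ xs) (.x ∷ʳ p) with ⊆-++⁻ xs p
... | σ₁ , σ₂ , refl , p₁ , p₂ = σ₁ , σ₂ , refl , x ∷ʳ p₁ , p₂
⊆-++⁻ (x ∷ xs) (refl ∷ p) with ⊆-++⁻ xs p
... | σ₁ , σ₂ , refl , p₁ , p₂ = x ∷ σ₁ , σ₂ , refl , refl ∷ p₁ , p₂

∈-of-⊆ : ∀ {A : Set} {x : A} {σ π} → x ∈ σ → σ ⊆ π → x ∈ π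
∈-of-⊆ x∈ p = Sublist.lookup p x∈

left-below : ∀ o l {x} → x ∈ word o l → x < o + size l
left-below o l = All.lookup (word-< o l)

right-above : ∀ o l r {x} → x ∈ (o + size l + size r) ∷ word (o + size l) r → o + size l ≤ x
right-above o l r = All.lookup (m≤m+n (o + size l) (size r) ∷ word-≥ (o + size l) r)

left<right : ∀ o l r {x y} → x ∈ word o l → y ∈ (o + size l + size r) ∷ word (o + size l) r → x < y
left<right o l r x∈ y∈ = ≤-trans (left-below o l x∈) (right-above o l r y∈)

-- Letters of the left word are below all later ones, while 231 ends with its least letter, so an
-- occurrence cannot straddle. Nor can the root, being the maximum, play the 2.
word-avoids-231 : ∀ o t → ¬ Has231 (word o t)
word-avoids-231 o ε (has231 () _ _)
word-avoids-231 o (node l r) (has231 sub a<b c≤a) with ⊆-++⁻ (word o l) sub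
... | [] , _ , refl , _ , _ ∷ʳ p = word-avoids-231 (o + size l) r (has231 p a<b c≤a)
... | [] , _ , refl , _ , refl ∷ p =
  <-asym a<b (All.lookup (wordʳ-< o l r) (∈-of-⊆ (here refl) p))
... | _ ∷ [] , _ , refl , p , q =
  ≤⇒≯ c≤a (left<right o l r (∈-of-⊆ (here refl) p) (∈-of-⊆ (there (here refl)) q))
... | _ ∷ _ ∷ [] , _ , refl , p , q =
  ≤⇒≯ c≤a (left<right o l r (∈-of-⊆ (here refl) p) (∈-of-⊆ (here refl) q))
... | _ ∷ _ ∷ _ ∷ [] , _ , refl , p , q = word-avoids-231 o l (has231 p a<b c≤a)

thin⇒avoids-132 : ∀ o {t} → Thin t → ¬ Has132 (word o t)
thin⇒avoids-132 o ε (has132 () _ _)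
thin⇒avoids-132 o (rightward th) (has132 (_ ∷ʳ p) a<c c≤b) = thin⇒avoids-132 (o + 0) th (has132 p a<c c≤b)
thin⇒avoids-132 o {node ε r} (rightward th) (has132 (refl ∷ p) a<c c≤b) =
  <-asym a<c (All.lookup (wordʳ-< o ε r) (∈-of-⊆ (there (here refl)) p))
thin⇒avoids-132 o {node l ε} (leftward th) (has132 sub a<c c≤b) with ⊆-++⁻ (word o l) sub
... | [] , _ , refl , _ , _ ∷ʳ ()
... | [] , _ , refl , _ , refl ∷ ()
... | _ ∷ [] , _ , refl , _ , _ ∷ʳ ()
... | _ ∷ [] , _ , refl , _ , refl ∷ ()
... | _ ∷ _ ∷ [] , _ , refl , p , q =
  ≤⇒≯ c≤b (left<right o l ε (∈-of-⊆ (there (here refl)) p) (∈-of-⊆ (here refl) q))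
... | _ ∷ _ ∷ _ ∷ [] , _ , refl , p , _ = thin⇒avoids-132 o th (has132 p a<c c≤b)

-- The pattern starts with its largest letter, so it cannot start in the left word and leave it. An
-- occurrence starting at the root or later puts a 132 into the right word.
spine⇒avoids-4132 : ∀ o {t} → Spine t → ¬ Has4132 (word o t)
spine⇒avoids-4132 o ε (has4132 () _ _ _)
spine⇒avoids-4132 o {node l r} (node sp th) (has4132 {a} {b} {c} {d} sub b<d d≤c c≤a)
  with ⊆-++⁻ (word o l) sub
... | [] , _ , refl , _ , _ ∷ʳ p = thin⇒avoids-132 (o + size l) th (has132 (Sublist.∷ˡ⁻ p) b<d d≤c)
... | [] , _ , refl , _ , refl ∷ p = thin⇒avoids-132 (o + size l) th (has132 p b<d d≤c)
... | _ ∷ [] , _ , refl , p , q =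
  ≤⇒≯ (≤-trans d≤c c≤a) (left<right o l r (∈-of-⊆ (here refl) p) (∈-of-⊆ (there (there (here refl))) q))
... | _ ∷ _ ∷ [] , _ , refl , p , q =
  ≤⇒≯ (≤-trans d≤c c≤a) (left<right o l r (∈-of-⊆ (here refl) p) (∈-of-⊆ (there (here refl)) q))
... | _ ∷ _ ∷ _ ∷ [] , _ , refl , p , q =
  ≤⇒≯ (≤-trans d≤c c≤a) (left<right o l r (∈-of-⊆ (here refl) p) (∈-of-⊆ (here refl) q))
... | _ ∷ _ ∷ _ ∷ _ ∷ [] , _ , refl , p , _ = spine⇒avoids-4132 o sp (has4132 p b<d d≤c c≤a)

label-∈ : ∀ o l r → o + size l + size r ∈ word o (node l r)
label-∈ o l r = ∈-insert (word o l)

avoids-132⇒thin : ∀ o t → ¬ Has132 (word o t) → Thin t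
avoids-132⇒thin o ε          _  = ε
avoids-132⇒thin o (node ε r) av = rightward (avoids-132⇒thin (o + 0) r
  λ (has132 p a<c c≤b) → av (has132 (_ ∷ʳ p) a<c c≤b))
avoids-132⇒thin o (node l ε) av = leftward (avoids-132⇒thin o l
  λ (has132 p a<c c≤b) → av (has132 (Sublist.++⁺ʳ _ p) a<c c≤b))
-- The labels of the left child, the root and the right child form a 132.
avoids-132⇒thin o (node l@(node l₁ l₂) r@(node r₁ r₂)) av = contradiction
  (has132 (Sublist.++⁺ (from∈ (label-∈ o l₁ l₂)) (refl ∷ from∈ (label-∈ (o + size l) r₁ r₂)))
          (left<right o l r (label-∈ o l₁ l₂) (there (label-∈ (o + size l) r₁ r₂)))
          (<⇒≤ (All.lookup (wordʳ-< o l r) (label-∈ (o + size l) r₁ r₂))))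
  av

avoids-4132⇒spine : ∀ o t → ¬ Has4132 (word o t) → Spine t
avoids-4132⇒spine o ε          _  = ε
avoids-4132⇒spine o (node l r) av = node
  (avoids-4132⇒spine o l λ (has4132 p b<d d≤c c≤a) → av (has4132 (Sublist.++⁺ʳ _ p) b<d d≤c c≤a))
  -- The root precedes and exceeds its right subtree, so it plays the 4 in front of any 132 there.
  (avoids-132⇒thin (o + size l) r λ (has132 p a<c c≤b) →
    av (has4132 (Sublist.++⁺ˡ (word o l) (refl ∷ p)) a<c c≤b
      (<⇒≤ (All.lookup (wordʳ-< o l r) (∈-of-⊆ (there (here refl)) p)))))

-- From 231-avoiding permutations back to trees

interval : ℕ → ℕ → List ℕ
interval o zero    = []
interval o (suc n) = o ∷ interval (suc o) n

interval-++ : ∀ o m n → interval o (m + n) ≡ interval o m ++ interval (o + m) n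
interval-++ o zero    n = cong (λ x → interval x n) (sym (+-identityʳ o))
interval-++ o (suc m) n = cong (o ∷_) (trans (interval-++ (suc o) m n)
  (cong (λ x → interval (suc o) m ++ interval x n) (sym (+-suc o m))))

interval-∷ʳ : ∀ o n → interval o (suc n) ≡ interval o n ++ [ o + n ]
interval-∷ʳ o n = trans (cong (interval o) (+-comm 1 n)) (interval-++ o n 1)

interval-≥ : ∀ o n → All (o ≤_) (interval o n)
interval-≥ o zero    = []
interval-≥ o (suc n) = ≤-refl ∷ All.map <⇒≤ (interval-≥ (suc o) n)

interval-< : ∀ o n → All (_< o + n) (interval o n)
interval-< o zero    = []
interval-< o (suc n) = m<m+n o (s≤s z≤n) ∷
  subst (λ b → All (_< b) (interval (suc o) n)) (sym (+-suc o n)) (interval-< (suc o) n)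

word-↭ : ∀ o t → word o t ↭ interval o (size t)
word-↭ o ε          = ↭-refl
word-↭ o (node l r) = ↭-trans (↭.shift _ (word o l) (word (o + size l) r))
  (↭-trans (prep _ (↭.++⁺ (word-↭ o l) (word-↭ (o + size l) r)))
  (↭-trans (∷↭∷ʳ _ _) (↭-reflexive (trans
    (cong₂ (λ xs k → xs ++ [ k ]) (sym (interval-++ o (size l) (size r))) (+-assoc o (size l) (size r)))
    (sym (interval-∷ʳ o (size l + size r)))))))

length-interval : ∀ o n → length (interval o n) ≡ n
length-interval o zero    = refl
length-interval o (suc n) = cong suc (length-interval (suc o) n)

size-of-word : ∀ o t → length (word o t) ≡ size t
size-of-word o t = trans (↭-length (word-↭ o t)) (length-interval o (size t))

-- Equal words have equal length, hence the same largest letter, and its first occurrence cuts both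
-- words at the same place.
word-injective : ∀ o t t′ → word o t ≡ word o t′ → t ≡ t′
word-injective o ε ε _ = refl
word-injective o ε (node l r) eq = contradiction (subst (o + size l + size r ∈_) (sym eq) (label-∈ o l r)) λ ()
word-injective o (node l r) ε eq = contradiction (subst (o + size l + size r ∈_) eq (label-∈ o l r)) λ ()
word-injective o (node l r) (node l′ r′) eq
  with first-occurrence (word o l) (word o l′) (∉-of-All< (wordˡ-< o l r))
         (subst (_∉ word o l′) (sym k≡) (∉-of-All< (wordˡ-< o l′ r′)))
         (trans eq (cong (λ k → word o l′ ++ k ∷ word (o + size l′) r′) (sym k≡)))
  where
  k≡ : o + size l + size r ≡ o + size l′ + size r′
  k≡ = trans (+-assoc o (size l) (size r)) (trans
    (cong (o +_) (suc-injective (trans (sym (size-of-word o (node l r))) (trans (cong length eq) (size-of-word o (node l′ r′))))))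
    (sym (+-assoc o (size l′) (size r′))))
... | eqL , eqR with word-injective o l l′ eqL
...   | refl = cong (node l) (word-injective (o + size l) r r′ eqR)

-- If L is nonempty, the least value `o` must lie in L. Deleting it leaves the same situation for
-- the interval that starts one higher.
interval-cut : ∀ o n L R → L ++ R ↭ interval o n → (∀ {x y} → x ∈ L → y ∈ R → x < y) →
               L ↭ interval o (length L) × R ↭ interval (o + length L) (length R)
interval-cut o n [] R perm _ =
  ↭-refl , subst (R ↭_) (cong₂ interval (sym (+-identityʳ o)) (sym (trans (↭-length perm) (length-interval o n)))) perm
interval-cut o zero (x ∷ L) R perm L<R = contradiction perm ↭.¬x∷xs↭[]
interval-cut o (suc n) L@(x ∷ _) R perm L<R with ∈-++⁻ L (∈-resp-↭ (↭-sym perm) (here refl))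
... | inj₂ o∈R = contradiction
  (All.lookup (interval-≥ o (suc n)) (∈-resp-↭ perm (here refl))) (<⇒≱ (L<R (here refl) o∈R))
... | inj₁ o∈L with ∈-∃++ o∈L
...   | A , B , L≡ with interval-cut (suc o) n (A ++ B) R
                          (subst (_↭ interval (suc o) n) (sym (++-assoc A B R))
                            (drop-mid A [] (subst (_↭ interval o (suc n))
                              (trans (cong (_++ R) L≡) (++-assoc A (o ∷ B) R)) perm)))
                          (λ x∈ y∈ → L<R (subst (_ ∈_) (sym L≡) (weaken x∈)) y∈)
  where
  weaken : ∀ {z} → z ∈ A ++ B → z ∈ A ++ o ∷ B
  weaken z∈ with ∈-++⁻ A z∈
  ... | inj₁ z∈A = ∈-++⁺ˡ z∈A
  ... | inj₂ z∈B = ∈-++⁺ʳ A (there z∈B)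
...     | AB↭ , R↭ =
  ↭-trans (↭-trans (↭-reflexive L≡) (↭.shift o A B))
    (↭-trans (prep o AB↭) (↭-reflexive (cong (interval o) (sym len)))) ,
  subst (λ k → R ↭ interval k (length R)) (trans (sym (+-suc o _)) (cong (o +_) (sym len))) R↭
  where
  len : length L ≡ suc (length (A ++ B))
  len = trans (cong length L≡) (trans (length-++ A) (trans (+-suc (length A) (length B)) (cong suc (sym (length-++ A)))))

-- The fuel f bounds the length of the word.
shape : ∀ f o n π → n ≤ f → π ↭ interval o n → ¬ Has231 π → ∃[ t ] word o t ≡ π
shape f o zero π _ perm _ = ε , sym (↭-empty-inv perm)
shape (suc f) o (suc n) π (s≤s n≤f) perm av
  with split-at-first (∈-resp-↭ (↭-sym (subst (π ↭_) (interval-∷ʳ o n) perm)) (∈-insert (interval o n)))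
... | L , R , refl , _ = glue (interval-cut o n L R rest L<R)
  where
  k = o + n
  rest : L ++ R ↭ interval o n
  rest = ↭-trans (drop-mid L (interval o n) (subst (L ++ k ∷ R ↭_) (interval-∷ʳ o n) perm))
                 (↭.++-identityʳ (interval o n))
  below : All (_< k) (L ++ R)
  below = All-resp-↭ (↭-sym rest) (interval-< o n)
  -- An x in L and a smaller or equal y in R would form a 231 with k between them.
  L<R : ∀ {x y} → x ∈ L → y ∈ R → x < y
  L<R x∈ y∈ = ≰⇒> λ y≤x →
    av (has231 (Sublist.++⁺ (from∈ x∈) (refl ∷ from∈ y∈)) (All.lookup below (∈-++⁺ˡ x∈)) y≤x)
  len : length L + length R ≡ n
  len = trans (sym (length-++ L)) (trans (↭-length rest) (length-interval o n))
  glue : L ↭ interval o (length L) × R ↭ interval (o + length L) (length R) → ∃[ t ] word o t ≡ L ++ k ∷ R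
  glue (L↭ , R↭)
    with shape f o (length L) L (≤-trans (subst (length L ≤_) len (m≤m+n _ _)) n≤f) L↭
           (λ (has231 p a<b c≤a) → av (has231 (Sublist.++⁺ʳ _ p) a<b c≤a))
       | shape f (o + length L) (length R) R (≤-trans (subst (length R ≤_) len (m≤n+m _ _)) n≤f) R↭
           (λ (has231 p a<b c≤a) → av (has231 (Sublist.++⁺ˡ L (k ∷ʳ p)) a<b c≤a))
  ... | l , refl | r , wr≡ = node l r , cong (word o l ++_) (cong₂ _∷_ k≡ wr≡′)
    where
    sl : length (word o l) ≡ size l
    sl = size-of-word o l
    wr≡′ : word (o + size l) r ≡ R
    wr≡′ = subst (λ z → word (o + z) r ≡ R) sl wr≡
    sr : length R ≡ size r
    sr = trans (cong length (sym wr≡)) (size-of-word (o + length (word o l)) r)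
    k≡ : o + size l + size r ≡ k
    k≡ = trans (+-assoc o (size l) (size r)) (cong (o +_) (trans (cong₂ _+_ (sym sl) (sym sr)) len))

-- Permutations and their preimages

insertions-↭ : ∀ x ys {π} → π ∈ insertions x ys → π ↭ x ∷ ys
insertions-↭ x []       (here refl) = ↭-refl
insertions-↭ x (y ∷ ys) (here refl) = ↭-refl
insertions-↭ x (y ∷ ys) (there π∈) with ∈-map⁻ (y ∷_) π∈
... | _ , τ∈ , refl = ↭-trans (prep y (insertions-↭ x ys τ∈)) (swap y x ↭-refl)

insertions-complete : ∀ x A B → A ++ x ∷ B ∈ insertions x (A ++ B)
insertions-complete x []      []      = here refl
insertions-complete x []      (_ ∷ _) = here refl
insertions-complete x (a ∷ A) B       = there (∈-map⁺ (a ∷_) (insertions-complete x A B))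

perms-↭ : ∀ xs {π} → π ∈ perms xs → π ↭ xs
perms-↭ []       (here refl) = ↭-refl
perms-↭ (x ∷ xs) π∈ with find (∈-concatMap⁻ (insertions x) {xs = perms xs} π∈)
... | ys , ys∈ , π∈ys = ↭-trans (insertions-↭ x ys π∈ys) (prep x (perms-↭ xs ys∈))

perms-complete : ∀ xs {π} → π ↭ xs → π ∈ perms xs
perms-complete []       perm = here (↭-empty-inv perm)
perms-complete (x ∷ xs) perm with ∈-∃++ (∈-resp-↭ (↭-sym perm) (here refl))
... | A , B , refl = ∈-concatMap⁺ (insertions x) (lose
  (perms-complete xs (drop-mid A [] perm)) (insertions-complete x A B))

insertions-unique : ∀ x ys → x ∉ ys → Unique (insertions x ys)
insertions-unique x []       _   = [] ∷ []
insertions-unique x (y ∷ ys) x∉ =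
  All.tabulate (λ {π} π∈ eq → let _ , _ , eq′ = ∈-map⁻ (y ∷_) π∈ in x∉ (here (∷-injectiveˡ (trans eq eq′)))) ∷
  Unique.map⁺ ∷-injectiveʳ (insertions-unique x ys (x∉ ∘ there))

-- A left inverse of inserting x, by which insertions into different words never coincide.
remove : ℕ → List ℕ → List ℕ
remove x = filter (λ y → ¬? (y ≟ x))

remove-∉ : ∀ {x} ys → x ∉ ys → remove x ys ≡ ys
remove-∉ {x} ys x∉ = filter-all (λ y → ¬? (y ≟ x)) (All.tabulate λ y∈ y≡x → x∉ (subst (_∈ ys) y≡x y∈))

remove-head : ∀ x ys → remove x (x ∷ ys) ≡ remove x ys
remove-head x ys = filter-reject (λ y → ¬? (y ≟ x)) (λ x≢x → x≢x refl)

remove-insertions : ∀ x ys {π} → x ∉ ys → π ∈ insertions x ys → remove x π ≡ ys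
remove-insertions x [] x∉ (here refl) = remove-head x []
remove-insertions x (y ∷ ys) x∉ (here refl) = trans (remove-head x (y ∷ ys)) (remove-∉ (y ∷ ys) x∉)
remove-insertions x (y ∷ ys) x∉ (there π∈) with ∈-map⁻ (y ∷_) π∈
... | τ , τ∈ , refl = trans (filter-accept (λ y → ¬? (y ≟ x)) (λ y≡x → x∉ (here (sym y≡x))))
                            (cong (y ∷_) (remove-insertions x ys (x∉ ∘ there) τ∈))

perms-unique : ∀ {xs} → Unique xs → Unique (perms xs)
perms-unique [] = [] ∷ []
perms-unique {x ∷ xs} u@(_ ∷ uxs) = concatMap-unique (insertions x) (perms-unique uxs)
  (λ ys ys∈ → insertions-unique x ys (x∉ ys∈))
  (λ {ys} {zs} ys∈ zs∈ π∈₁ π∈₂ →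
    trans (sym (remove-insertions x ys (x∉ ys∈) π∈₁)) (remove-insertions x zs (x∉ zs∈) π∈₂))
  where
  x∉ : ∀ {ys} → ys ∈ perms xs → x ∉ ys
  x∉ ys∈ x∈ = Unique[x∷xs]⇒x∉xs u (∈-resp-↭ (perms-↭ xs ys∈) x∈)

range≡interval : ∀ n → range n ≡ interval 1 n
range≡interval n = trans (cong (map suc) (upTo≡ n)) (shifted 0 n)
  where
  shifted : ∀ o n → map suc (interval o n) ≡ interval (suc o) n
  shifted o zero    = refl
  shifted o (suc n) = cong (suc o ∷_) (shifted (suc o) n)
  upTo≡ : ∀ n → upTo n ≡ interval 0 n
  upTo≡ zero    = refl
  upTo≡ (suc n) = cong (0 ∷_) (trans (sym (map-upTo suc n)) (trans (cong (map suc) (upTo≡ n)) (shifted 0 n)))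

Perm-↭ : ∀ n {π} → π ∈ Perm n → π ↭ interval 1 n
Perm-↭ n {π} π∈ = subst (π ↭_) (range≡interval n) (perms-↭ (range n) π∈)

Perm-complete : ∀ n {π} → π ↭ interval 1 n → π ∈ Perm n
Perm-complete n {π} perm = perms-complete (range n) (subst (π ↭_) (sym (range≡interval n)) perm)

Perm-unique : ∀ n → Unique (Perm n)
Perm-unique n = perms-unique (Unique.map⁺ suc-injective (Unique.upTo⁺ n))

eqList-sound : ∀ xs ys → T (eqList xs ys) → xs ≡ ys
eqList-sound []       []       _ = refl
eqList-sound (x ∷ xs) (y ∷ ys) h =
  let x≡y , xs≡ys = Equivalence.to T-∧ h in cong₂ _∷_ (≡ᵇ⇒≡ x y x≡y) (eqList-sound xs ys xs≡ys)

eqList-refl : ∀ xs → T (eqList xs xs)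
eqList-refl []       = tt
eqList-refl (x ∷ xs) = Equivalence.from T-∧ (≡⇒≡ᵇ x x refl , eqList-refl xs)

T-∧₃ : ∀ a b c → T (a ∧ b ∧ c) ⇔ (T a × T b × T c)
T-∧₃ true  true  c = mk⇔ (λ h → tt , tt , h) (λ (_ , _ , h) → h)
T-∧₃ true  false c = mk⇔ (λ ()) (λ ())
T-∧₃ false b     c = mk⇔ (λ ()) (λ ())

-- Ranges over all words, whereas `preimageCount` searches only `Perm n`. The two agree because
-- `s σ` is a permutation of σ.
UniquePreimage : List ℕ → Set
UniquePreimage π = ∃[ σ ] s σ ≡ π × (∀ σ′ → s σ′ ≡ π → σ′ ≡ σ)

module _ {n π} (π∈ : π ∈ Perm n) where

  preimages : List (List ℕ)
  preimages = filter (λ σ → T? (eqList (s σ) π)) (Perm n)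

  preimages-sound : ∀ {σ} → σ ∈ preimages → s σ ≡ π
  preimages-sound {σ} σ∈ =
    eqList-sound (s σ) π (proj₂ (∈-filter⁻ (λ σ → T? (eqList (s σ) π)) {xs = Perm n} σ∈))

  preimages-complete : ∀ {σ} → s σ ≡ π → σ ∈ preimages
  preimages-complete {σ} refl = ∈-filter⁺ (λ σ′ → T? (eqList (s σ′) (s σ)))
    (Perm-complete n (↭-trans (↭-sym (s-↭ σ)) (Perm-↭ n π∈))) (eqList-refl (s σ))

  preimages-unique : Unique preimages
  preimages-unique = Unique.filter⁺ (λ σ → T? (eqList (s σ) π)) (Perm-unique n)

  uniquelySorted⁻ : T (uniquelySorted n π) → UniquePreimage π
  uniquelySorted⁻ h = singleton preimages refl (≡ᵇ⇒≡ (length preimages) 1 h)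
    where
    singleton : ∀ σs → preimages ≡ σs → length σs ≡ 1 → UniquePreimage π
    singleton (σ ∷ []) eq _ = σ , preimages-sound (subst (σ ∈_) (sym eq) (here refl)) , only
      where
      only : ∀ σ′ → s σ′ ≡ π → σ′ ≡ σ
      only σ′ sσ′ with subst (σ′ ∈_) eq (preimages-complete sσ′)
      ... | here σ′≡σ = σ′≡σ

  uniquelySorted⁺ : UniquePreimage π → T (uniquelySorted n π)
  uniquelySorted⁺ (σ , sσ , only) = ≡⇒≡ᵇ (length preimages) 1
    (singleton preimages preimages-unique (preimages-complete sσ) λ σ′∈ → only _ (preimages-sound σ′∈))
    where
    singleton : ∀ σs → Unique σs → σ ∈ σs → (∀ {σ′} → σ′ ∈ σs → σ′ ≡ σ) → length σs ≡ 1
    singleton (_ ∷ [])     _ _ _ = refl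
    singleton (τ ∷ υ ∷ σs) ((τ≢υ ∷ _) ∷ _) _ all≡ =
      contradiction (trans (all≡ (here refl)) (sym (all≡ (there (here refl))))) τ≢υ

rigid⇒uniquePreimage : ∀ o t → Rigid t → blocks t ≡ 1 → UniquePreimage (word o t)
rigid⇒uniquePreimage o t rigid b≡ with subst (λ j → Cut j (word o t)) b≡ (blocks-cut o t)
... | σ ∷ [] , _ , eq = σ , eq , λ σ′ eq′ → ∷-injectiveˡ
  (subst (λ j → UniqueCut j (word o t)) b≡ (rigid⇒unique o rigid) (σ′ ∷ []) (σ ∷ []) refl refl eq′ eq)

-- A preimage is a cut into one block. The empty tree is left out: its word also has exactly one
-- preimage, but it needs no block.
uniquePreimage⇒rigid : ∀ o l r → UniquePreimage (word o (node l r)) →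
                       Rigid (node l r) × blocks (node l r) ≡ 1
uniquePreimage⇒rigid o l r (σ , sσ , only) = unique⇒rigid o (node l r) unq , b≡
  where
  b≡ : blocks (node l r) ≡ 1
  b≡ = ≤-antisym (blocks-≤ o (node l r) (σ ∷ []) sσ) (s≤s z≤n)
  unq : UniqueCut (blocks (node l r)) (word o (node l r))
  unq (τ ∷ []) (τ′ ∷ []) _ _ eq eq′ = cong [_] (trans (only τ eq) (sym (only τ′ eq′)))
  unq []          _           len _ _ _ = contradiction (trans len b≡) λ ()
  unq (_ ∷ _ ∷ _) _           len _ _ _ = contradiction (trans len b≡) λ ()
  unq (_ ∷ [])    []          _ len _ _ = contradiction (trans len b≡) λ ()
  unq (_ ∷ [])    (_ ∷ _ ∷ _) _ len _ _ = contradiction (trans len b≡) λ ()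

-- The bijection with trees and the count

module _ (k : ℕ) where
  private
    n = 2 * k + 1
    -- The index 0 means one block, the last index gives size 1 + 2k, and `suc k` is the least fuel
    -- above k.
    shapes = spineTrees (suc k) 0 k
    inU = λ π → T? (uniquelySorted n π ∧ avoids π (2 ∷ 3 ∷ 1 ∷ []) ∧ avoids π (4 ∷ 1 ∷ 3 ∷ 2 ∷ []))

    conditions : ∀ π → T (uniquelySorted n π ∧ avoids π (2 ∷ 3 ∷ 1 ∷ []) ∧ avoids π (4 ∷ 1 ∷ 3 ∷ 2 ∷ [])) ⇔
                 (T (uniquelySorted n π) × T (avoids π (2 ∷ 3 ∷ 1 ∷ [])) × T (avoids π (4 ∷ 1 ∷ 3 ∷ 2 ∷ [])))
    conditions π = T-∧₃ (uniquelySorted n π) (avoids π (2 ∷ 3 ∷ 1 ∷ [])) (avoids π (4 ∷ 1 ∷ 3 ∷ 2 ∷ []))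

  U⇒shape : ∀ {π} → π ∈ U n → π ∈ map (word 1) shapes
  U⇒shape {π} π∈U with ∈-filter⁻ inU {xs = Perm n} π∈U
  ... | π∈ , h with Equivalence.to (conditions π) h
  ...   | us , av231 , av4132
    with shape n 1 n π ≤-refl (Perm-↭ n π∈) (avoids⁻ π _ av231 ∘ has231⇒occurs231)
  ...       | ε , refl = contradiction (trans (↭-length (Perm-↭ n π∈)) (trans (length-interval 1 n) (+-comm (2 * k) 1))) λ ()
  ...       | t@(node l r) , refl with uniquePreimage⇒rigid 1 l r (uniquelySorted⁻ {n} π∈ us)
  ...         | rigid , b≡ with spineTrees-complete
                                  (avoids-4132⇒spine 1 t (avoids⁻ π _ av4132 ∘ has4132⇒occurs4132)) rigid
  ...           | m , t∈ = ∈-map⁺ (word 1) (subst₂ (λ d m → t ∈ spineTrees (suc k) d m) d≡ m≡ (t∈ (suc k) (s≤s (≤-reflexive m≡))))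
    where
    d≡ : blocks l ∸ 2 + blocks r ≡ 0
    d≡ = suc-injective b≡
    -- The index m from completeness is recovered from the size. The fuel `suc m` is used here,
    -- since it is known to suffice before m is identified with k.
    m≡ : m ≡ k
    m≡ = *-cancelˡ-≡ m k 2 (suc-injective (trans
      (sym (IsSpine.size≡ (spineTrees-sound (suc m) 0 m (subst (λ d → t ∈ spineTrees (suc m) d m) d≡ (t∈ (suc m) ≤-refl)))))
      (trans (sym (size-of-word 1 t)) (trans (↭-length (Perm-↭ n π∈)) (trans (length-interval 1 n) (+-comm (2 * k) 1))))))

  shape⇒U : ∀ {π} → π ∈ map (word 1) (shapes) → π ∈ U n
  shape⇒U π∈ with ∈-map⁻ (word 1) π∈
  ... | t , t∈ , refl = ∈-filter⁺ inU w∈ (Equivalence.from (conditions (word 1 t))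
    ( uniquelySorted⁺ {n} w∈ (rigid⇒uniquePreimage 1 t rigid blocks≡)
    , avoids⁺ (word 1 t) _ (word-avoids-231 1 t ∘ occurs231⇒has231)
    , avoids⁺ (word 1 t) _ (spine⇒avoids-4132 1 spined ∘ occurs4132⇒has4132)))
    where
    open IsSpine (spineTrees-sound (suc k) 0 k t∈)
    w∈ : word 1 t ∈ Perm n
    w∈ = Perm-complete n (subst (λ m → word 1 t ↭ interval 1 m) (trans size≡ (+-comm 1 (2 * k))) (word-↭ 1 t))

  U↭shapes : U n ↭ map (word 1) (shapes)
  U↭shapes = ∼bag⇒↭ (unique∧set⇒bag
    (Unique.filter⁺ inU (Perm-unique n))
    (Unique.map⁺ (word-injective 1 _ _) (spineTrees-unique (suc k) 0 k))
    (mk⇔ U⇒shape shape⇒U))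

  length-U : length (U n) ≡ spine 0 k
  length-U = trans (↭-length U↭shapes) (trans (length-map (word 1) shapes) (length-spineTrees (suc k) 0 k ≤-refl))

theorem8p1 : ∀ (k : ℕ) → length (U (2 * k + 1)) ≡ compose C xC k
theorem8p1 k = trans (length-U k) (spine-compose k)
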